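{- Let $d>3$ be even and let $C=C(2,0,\ldots,0,2)$ be the caterpillar of diameter $d$ (so its spine has $d-1$ vertices, the two end vertices of the spine are each adjacent to exactly two vertices of degree 1, and the other spine vertices are adjacent to none). Then $\mathrm{ern}(C)=3$.
   Context: All graphs are finite, simple and undirected. An edge-card of a graph $G$ is an edge-deleted subgraph $G-e$ (all vertices are kept), considered up to isomorphism. For distinct edges $e_1,\dots,e_k$ of $G$, the edge-cards $G-e_1,\dots,G-e_k$ are said to reconstruct $G$ if every graph $H$ having distinct edges $f_1,\dots,f_k$ with $H-f_i\simeq G-e_i$ for all $i$ is isomorphic to $G$ ($H$ ranges over all graphs, not only trees). The edge-reconstruction number $\mathrm{ern}(G)$ is the least $k$ for which some $k$ edge-cards of $G$ reconstruct $G$. A caterpillar is a tree in which deleting all vertices of degree 1 leaves a path, called the spine. $C(a_1,\dots,a_s)$ denotes the caterpillar with spine the path $v_1v_2\cdots v_s$ in which $v_i$ is adjacent to exactly $a_i$ vertices of degree 1. The diameter of a tree is the number of edges of a longest path. -}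

module Defs where

open import Data.Empty using (⊥)
open import Data.Fin using (Fin; zero; suc; toℕ; inject₁)
open import Data.Fin.Properties using (+↔⊎; inj⇒≟)
open import Data.Nat using (ℕ; zero; suc; _+_; _≤_; _≟_)
open import Data.Nat.Properties using (1+n≢n)
open import Data.Product using (Σ; ∃-syntax; _×_; _,_)
open import Data.Sum using (_⊎_; inj₁; inj₂; swap)
open import Data.Sum.Function.Propositional using (_⊎-↔_)
open import Data.Vec using (Vec; []; _∷_; lookup)
open import Function.Base using (_∘_)
open import Function.Bundles using (_↔_; _⇔_; Inverse; mk↔ₛ′)
open import Function.Construct.Composition using (_↔-∘_)
open import Function.Construct.Identity using (↔-id)
open import Function.Construct.Symmetry using (↔-sym)
open import Function.Definitions using (Injective)
open import Function.Properties.Inverse using (↔⇒↣)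
open import Level using (0ℓ)
open import Relation.Binary.Core using (Rel)
open import Relation.Binary.Definitions using (Decidable; DecidableEquality; Symmetric)
open import Relation.Binary.PropositionalEquality using (_≡_; refl; sym)
open import Relation.Nullary using (¬_; yes; no)
open import Relation.Nullary.Decidable using (_×-dec_; _⊎-dec_; ¬?)

Finite : Set → Set
Finite A = ∃[ n ] (A ↔ Fin n)

record Graph : Set₁ where
  infix 4 _~_ _~?_
  field
    Vertex   : Set
    finite   : Finite Vertex
    _~_      : Rel Vertex 0ℓ
    _~?_     : Decidable _~_
    ~-sym    : Symmetric _~_
    ~-irrefl : ∀ {v} → ¬ (v ~ v)

  infix 4 _≟ᵛ_
  _≟ᵛ_ : DecidableEquality Vertex
  _≟ᵛ_ with finite
  ... | _ , V↔Fin = inj⇒≟ (↔⇒↣ V↔Fin)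

open Graph using (Vertex)

infix 4 _≃_
record _≃_ (G H : Graph) : Set where
  private
    module G = Graph G
    module H = Graph H
  field
    bijection : G.Vertex ↔ H.Vertex
  open Inverse bijection public using (to; from)
  field
    preserves : ∀ u v → (u G.~ v) ⇔ (to u H.~ to v)

-- Each undirected edge is listed with both orientations; _≈_ identifies them.
record Edge (G : Graph) : Set where
  constructor edge
  open Graph G using (_~_)
  field
    {source target} : Vertex G
    adjacent        : source ~ target

SameEnds : {V : Set} → V → V → V → V → Set
SameEnds u v x y = (u ≡ x × v ≡ y) ⊎ (u ≡ y × v ≡ x)

infix 4 _≈_
_≈_ : {G : Graph} → Rel (Edge G) 0ℓ
e ≈ f = SameEnds (Edge.source e) (Edge.target e) (Edge.source f) (Edge.target f)

infixl 6 _-_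
_-_ : (G : Graph) → Edge G → Graph
G - e = record
  { Vertex   = Vertex G
  ; finite   = finite
  ; _~_      = λ u v → u ~ v × ¬ SameEnds u v source target
  ; _~?_     = λ u v → (u ~? v) ×-dec
                 ¬? (((u ≟ᵛ source) ×-dec (v ≟ᵛ target)) ⊎-dec
                     ((u ≟ᵛ target) ×-dec (v ≟ᵛ source)))
  ; ~-sym    = λ (u~v , u≉v) → ~-sym u~v , λ s → u≉v (flip s)
  ; ~-irrefl = λ (v~v , _) → ~-irrefl v~v
  }
  where
  open Graph G hiding (Vertex)
  open Edge e
  flip : ∀ {u v x y : Vertex G} → SameEnds v u x y → SameEnds u v x y
  flip (inj₁ (p , q)) = inj₂ (q , p)
  flip (inj₂ (p , q)) = inj₁ (q , p)

Distinct : {G : Graph} {k : ℕ} → (Fin k → Edge G) → Set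
Distinct e = Injective _≡_ _≈_ e

Reconstruct : (G : Graph) {k : ℕ} → (Fin k → Edge G) → Set₁
Reconstruct G {k} e =
  ∀ (H : Graph) (f : Fin k → Edge H) → Distinct f →
  (∀ i → H - f i ≃ G - e i) → H ≃ G

ReconstructibleFrom : Graph → ℕ → Set₁
ReconstructibleFrom G k =
  Σ (Fin k → Edge G) λ e → Distinct e × Reconstruct G e

-- The edge-reconstruction number as a relation, since a least k need not exist
-- for every graph.
HasErn : Graph → ℕ → Set₁
HasErn G k = ReconstructibleFrom G k × (∀ j → ReconstructibleFrom G j → k ≤ j)

record Path (G : Graph) (length : ℕ) : Set where
  open Graph G using (_~_)
  field
    vertex    : Fin (suc length) → Vertex G
    injective : Injective _≡_ _≡_ vertex
    adjacent  : ∀ i → vertex (inject₁ i) ~ vertex (suc i)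

-- The diameter in the sense appropriate to trees: the length of a longest path.
HasDiameter : Graph → ℕ → Set
HasDiameter T d = Path T d × (∀ k → Path T k → k ≤ d)

Σ-finite : ∀ {s} (a : Vec ℕ s) → Finite (Σ (Fin s) (Fin ∘ lookup a))
Σ-finite []      = 0 , mk↔ₛ′ (λ ()) (λ ()) (λ ()) (λ ())
Σ-finite (x ∷ a) with Σ-finite a
... | n , Σ↔Fin = x + n , ↔-sym +↔⊎ ↔-∘ ((↔-id (Fin x) ⊎-↔ Σ↔Fin) ↔-∘ split)
  where
  to : Σ (Fin _) (Fin ∘ lookup (x ∷ a)) → Fin x ⊎ Σ (Fin _) (Fin ∘ lookup a)
  to (zero  , j) = inj₁ j
  to (suc i , j) = inj₂ (i , j)
  from : Fin x ⊎ Σ (Fin _) (Fin ∘ lookup a) → Σ (Fin _) (Fin ∘ lookup (x ∷ a))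
  from (inj₁ j)       = zero , j
  from (inj₂ (i , j)) = suc i , j
  split : Σ (Fin _) (Fin ∘ lookup (x ∷ a)) ↔ (Fin x ⊎ Σ (Fin _) (Fin ∘ lookup a))
  split = mk↔ₛ′ to from
    (λ { (inj₁ _) → refl ; (inj₂ _) → refl })
    (λ { (zero , _) → refl ; (suc _ , _) → refl })

pattern spine i  = inj₁ i
pattern leaf i j = inj₂ (i , j)

-- The spine is the path  spine 0, spine 1, …  and  leaf i j  is the j-th of the
-- lookup a i  pendant vertices attached to  spine i.  The pendant vertices are
-- exactly the vertices of degree 1 when a has at least two entries and its
-- first and last entries are nonzero.
module Caterpillar {s : ℕ} (a : Vec ℕ s) where

  V : Set
  V = Fin s ⊎ Σ (Fin s) (Fin ∘ lookup a)

  Adj : Rel V 0ℓ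
  Adj (spine i)  (spine j)  = toℕ j ≡ suc (toℕ i) ⊎ toℕ i ≡ suc (toℕ j)
  Adj (spine i)  (leaf j _) = i ≡ j
  Adj (leaf i _) (spine j)  = i ≡ j
  Adj (leaf _ _) (leaf _ _) = ⊥

  adj? : Decidable Adj
  adj? (spine i)  (spine j)  = (toℕ j ≟ suc (toℕ i)) ⊎-dec (toℕ i ≟ suc (toℕ j))
  adj? (spine i)  (leaf j _) = i Data.Fin.≟ j
  adj? (leaf i _) (spine j)  = i Data.Fin.≟ j
  adj? (leaf _ _) (leaf _ _) = no λ ()

  adj-sym : Symmetric Adj
  adj-sym {spine _}  {spine _}  p = swap p
  adj-sym {spine _}  {leaf _ _} p = sym p
  adj-sym {leaf _ _} {spine _}  p = sym p

  adj-irrefl : ∀ {v} → ¬ Adj v v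
  adj-irrefl {spine _} (inj₁ p) = 1+n≢n (sym p)
  adj-irrefl {spine _} (inj₂ p) = 1+n≢n (sym p)

  V-finite : Finite V
  V-finite with Σ-finite a
  ... | n , Σ↔Fin = s + n , ↔-sym +↔⊎ ↔-∘ (↔-id (Fin s) ⊎-↔ Σ↔Fin)

C : ∀ {s} → Vec ℕ s → Graph
C a = record
  { Vertex   = V
  ; finite   = V-finite
  ; _~_      = Adj
  ; _~?_     = adj?
  ; ~-sym    = λ {u} {v} → adj-sym {u} {v}
  ; ~-irrefl = λ {v} → adj-irrefl {v}
  }
  where open Caterpillar a

{-# OPTIONS --safe #-}
module Submission where

-- Let S(a,b,n) be the spider with legs of these lengths and m = d - 3 = 2t + 1.
-- Deleting a pendant edge of C leaves an isolated vertex and S(1,1,m+2); deleting a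
-- spine edge leaves S(1,1,i) and S(1,1,j) with i + j = m.
--
-- Three cards suffice: a pendant card together with the two cards having a claw
-- S(1,1,1) as a component.  Since the latter have no isolated vertex, a graph H with
-- these cards is S(1,1,m+2) with one pendant vertex attached somewhere, and unless it
-- is attached as in C, only one edge of H leaves a claw component when deleted.
--
-- Two cards do not.  Two pendant cards also come from S(1,1,1,m+2); a pendant card and
-- a spine card from S(1,1,m+2) with the pendant vertex attached elsewhere on the long
-- leg; two spine cards from a tree with three branch vertices, where the tails of two
-- spiders and a path meet in one vertex.  The last construction gives C itself when
-- both cards are S(1,1,t) + S(1,1,t+1); then an edge closing a cycle inside one of the
-- two components gives a disconnected graph with these cards.  The trees are told
-- apart from C by a leaf whose neighbour has no other leaf neighbour.

open import Data.Bool using (Bool; true; false)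
open import Data.Empty using (⊥; ⊥-elim)
open import Data.Fin using (Fin; zero; suc; toℕ; inject₁)
open import Data.Fin.Properties using (+↔⊎; 1↔⊤; injective⇒≤; inject₁-injective)
import Data.Fin.Properties as Fin
open import Data.Nat using (ℕ; zero; suc; _+_; _≤_; _<_; z≤n; s≤s; _≟_; _≤?_)
open import Data.Nat.Properties using
  ( +-suc; +-identityʳ; +-comm; +-assoc; +-cancelˡ-≡; *-comm
  ; suc-injective; ≰⇒>; ≤-antisym; m≤n⇒∃[o]m+o≡n)
open import Data.Nat.Divisibility using (_∣_; divides)
open import Data.Product using (Σ; ∃-syntax; _×_; _,_; proj₁; proj₂)
open import Data.Sum using (_⊎_; inj₁; inj₂; swap)
open import Data.Sum.Properties using (inj₂-injective)
import Data.Sum.Function.Propositional as Sum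
open import Data.Unit using (⊤; tt)
open import Data.Vec using (Vec; []; _∷_; _∷ʳ_; lookup; map; replicate)
open import Data.Vec.Membership.Propositional using (_∈_)
open import Data.Vec.Membership.Propositional.Properties using (∈-map⁺)
import Data.Vec.Relation.Unary.All as All
import Data.Vec.Relation.Unary.All.Properties as All
open import Data.Vec.Relation.Unary.All using (All; []; _∷_)
open import Data.Vec.Relation.Unary.AllPairs using ([]; _∷_)
open import Data.Vec.Relation.Unary.Any using (index; here; there)
open import Data.Vec.Relation.Unary.Any.Properties using (lookup-index)
open import Data.Vec.Relation.Unary.Unique.Propositional using (Unique)
import Data.Vec.Relation.Unary.Unique.Propositional.Properties as Unique
open import Function using (_∘_; id)
open import Function.Bundles using (_↔_; Inverse; Equivalence; mk↔ₛ′; mk⇔)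
open import Function.Construct.Composition using (_↔-∘_)
open import Function.Construct.Identity using (↔-id)
open import Function.Construct.Symmetry using (↔-sym)
open import Level using (0ℓ)
open import Relation.Binary.Core using (Rel)
open import Relation.Binary.Definitions using (Decidable; DecidableEquality; Symmetric)
open import Relation.Binary.PropositionalEquality
open import Relation.Nullary using (¬_; Dec; yes; no)
open import Relation.Nullary.Decidable using (map′; _⊎-dec_; _×-dec_)
open import Defs
open Graph using (Vertex)

-- Isomorphisms of graphs and deletion of an edge.

infix 4 _[_~_]
_[_~_] : (G : Graph) → Vertex G → Vertex G → Set
G [ u ~ v ] = Graph._~_ G u v

variable
  G H K : Graph

same-swap : ∀ {V : Set} {u v x y : V} → SameEnds u v x y → SameEnds u v y x
same-swap (inj₁ p) = inj₂ p
same-swap (inj₂ p) = inj₁ p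

same-sym : ∀ {V : Set} {u v x y : V} → SameEnds u v x y → SameEnds x y u v
same-sym (inj₁ (refl , refl)) = inj₁ (refl , refl)
same-sym (inj₂ (refl , refl)) = inj₂ (refl , refl)

same-trans : ∀ {V : Set} {u v x y s t : V} →
  SameEnds u v x y → SameEnds x y s t → SameEnds u v s t
same-trans (inj₁ (refl , refl)) q = q
same-trans (inj₂ (refl , refl)) (inj₁ (refl , refl)) = inj₂ (refl , refl)
same-trans (inj₂ (refl , refl)) (inj₂ (refl , refl)) = inj₁ (refl , refl)

same-map : ∀ {V W : Set} (g : V → W) {u v x y : V} →
  SameEnds u v x y → SameEnds (g u) (g v) (g x) (g y)
same-map g (inj₁ (refl , refl)) = inj₁ (refl , refl)
same-map g (inj₂ (refl , refl)) = inj₂ (refl , refl)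

same? : (G : Graph) (u v x y : Vertex G) → Dec (SameEnds u v x y)
same? G u v x y = ((u ≟ᵛ x) ×-dec (v ≟ᵛ y)) ⊎-dec ((u ≟ᵛ y) ×-dec (v ≟ᵛ x))
  where open Graph G

mk≃ : (bij : Vertex G ↔ Vertex H) →
  (∀ {u v} → G [ u ~ v ] → H [ Inverse.to bij u ~ Inverse.to bij v ]) →
  (∀ {u v} → H [ u ~ v ] → G [ Inverse.from bij u ~ Inverse.from bij v ]) →
  G ≃ H
mk≃ {G} bij hom back = record
  { bijection = bij
  ; preserves = λ u v → mk⇔ hom
      (λ p → subst₂ (G [_~_]) (strictlyInverseʳ u) (strictlyInverseʳ v) (back p))
  }
  where open Inverse bij

module Iso {G H : Graph} (φ : G ≃ H) where
  open _≃_ φ public using (to; from; bijection)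
  open Inverse bijection public
    using () renaming (strictlyInverseˡ to to-from; strictlyInverseʳ to from-to)

  hom : ∀ {u v} → G [ u ~ v ] → H [ to u ~ to v ]
  hom = Equivalence.to (_≃_.preserves φ _ _)

  back : ∀ {u v} → H [ u ~ v ] → G [ from u ~ from v ]
  back {u} {v} p = Equivalence.from (_≃_.preserves φ _ _)
    (subst₂ (H [_~_]) (sym (to-from u)) (sym (to-from v)) p)

  to-injective : ∀ {u v} → to u ≡ to v → u ≡ v
  to-injective {u} {v} p = trans (sym (from-to u)) (trans (cong from p) (from-to v))

  from-injective : ∀ {u v} → from u ≡ from v → u ≡ v
  from-injective {u} {v} p = trans (sym (to-from u)) (trans (cong to p) (to-from v))

  same-to⁻¹ : ∀ {u v x y} → SameEnds (to u) (to v) (to x) (to y) → SameEnds u v x y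
  same-to⁻¹ (inj₁ (p , q)) = inj₁ (to-injective p , to-injective q)
  same-to⁻¹ (inj₂ (p , q)) = inj₂ (to-injective p , to-injective q)

≃-refl : G ≃ G
≃-refl {G} = mk≃ (↔-id _) id id

≃-sym : G ≃ H → H ≃ G
≃-sym φ = mk≃ (↔-sym bijection) back hom
  where open Iso φ

≃-trans : G ≃ H → H ≃ K → G ≃ K
≃-trans φ ψ = mk≃ (Ψ.bijection ↔-∘ Φ.bijection) (Ψ.hom ∘ Φ.hom) (Φ.back ∘ Ψ.back)
  where
  module Φ = Iso φ
  module Ψ = Iso ψ

mapEdge : G ≃ H → Edge G → Edge H
mapEdge φ e = edge (Iso.hom φ (Edge.adjacent e))

mapEdge-injective : (φ : G ≃ H) {e f : Edge G} → mapEdge φ e ≈ mapEdge φ f → e ≈ f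
mapEdge-injective φ = Iso.same-to⁻¹ φ

delete-iso : (φ : G ≃ H) (e : Edge G) → G - e ≃ H - mapEdge φ e
delete-iso {G} {H} φ e = mk≃ bijection
  (λ (p , ¬s) → hom p , λ s → ¬s (same-to⁻¹ s))
  (λ {u} {v} (p , ¬s) → back p , λ s →
     ¬s (subst₂ (λ x y → SameEnds x y _ _) (to-from u) (to-from v) (same-map to s)))
  where open Iso φ

delete-≈ : {e f : Edge G} → e ≈ f → G - e ≃ G - f
delete-≈ e≈f = mk≃ (↔-id _)
  (λ (p , ¬s) → p , λ s → ¬s (same-trans s (same-sym e≈f)))
  (λ (p , ¬s) → p , λ s → ¬s (same-trans s e≈f))

reverse : Edge G → Edge G
reverse {G} e = edge (Graph.~-sym G (Edge.adjacent e))

delete-reverse : (e : Edge G) → G - e ≃ G - reverse e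
delete-reverse e = delete-≈ {e = e} {reverse e} (inj₂ (refl , refl))

-- Disjoint unions and added edges.

data UnionAdj {V W : Set} (R : Rel V 0ℓ) (S : Rel W 0ℓ) : Rel (V ⊎ W) 0ℓ where
  left  : ∀ {u v} → R u v → UnionAdj R S (inj₁ u) (inj₁ v)
  right : ∀ {u v} → S u v → UnionAdj R S (inj₂ u) (inj₂ v)

data AddAdj {V : Set} (R : Rel V 0ℓ) (x y : V) : Rel V 0ℓ where
  old : ∀ {u v} → R u v → AddAdj R x y u v
  new : AddAdj R x y x y
  wen : AddAdj R x y y x

-- Graph has η, so conversion of graphs compares all fields; opacity keeps that cheap.
opaque
  ⊎-finite : ∀ {V W} → Finite V → Finite W → Finite (V ⊎ W)
  ⊎-finite (_ , p) (_ , q) = _ , ↔-sym +↔⊎ ↔-∘ (p Sum.⊎-↔ q)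

  union? : ∀ {V W : Set} {R : Rel V 0ℓ} {S : Rel W 0ℓ} →
    Decidable R → Decidable S → Decidable (UnionAdj R S)
  union? R? S? (inj₁ u) (inj₁ v) = map′ left (λ { (left p) → p }) (R? u v)
  union? R? S? (inj₁ u) (inj₂ v) = no λ ()
  union? R? S? (inj₂ u) (inj₁ v) = no λ ()
  union? R? S? (inj₂ u) (inj₂ v) = map′ right (λ { (right p) → p }) (S? u v)

  union-sym : ∀ {V W : Set} {R : Rel V 0ℓ} {S : Rel W 0ℓ} →
    Symmetric R → Symmetric S → Symmetric (UnionAdj R S)
  union-sym R-sym S-sym (left p)  = left (R-sym p)
  union-sym R-sym S-sym (right p) = right (S-sym p)

  union-irrefl : ∀ {V W : Set} {R : Rel V 0ℓ} {S : Rel W 0ℓ} →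
    (∀ {v} → ¬ R v v) → (∀ {v} → ¬ S v v) → ∀ {v} → ¬ UnionAdj R S v v
  union-irrefl R-irrefl S-irrefl (left p)  = R-irrefl p
  union-irrefl R-irrefl S-irrefl (right p) = S-irrefl p

  add? : ∀ {V : Set} {R : Rel V 0ℓ} {x y} →
    DecidableEquality V → Decidable R → Decidable (AddAdj R x y)
  add? {x = x} {y} _≟_ R? u v = map′
    (λ { (inj₁ p) → old p ; (inj₂ (inj₁ (refl , refl))) → new
       ; (inj₂ (inj₂ (refl , refl))) → wen })
    (λ { (old p) → inj₁ p ; new → inj₂ (inj₁ (refl , refl))
       ; wen → inj₂ (inj₂ (refl , refl)) })
    (R? u v ⊎-dec (((u ≟ x) ×-dec (v ≟ y)) ⊎-dec ((u ≟ y) ×-dec (v ≟ x))))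

  add-sym : ∀ {V : Set} {R : Rel V 0ℓ} {x y} → Symmetric R → Symmetric (AddAdj R x y)
  add-sym R-sym (old p) = old (R-sym p)
  add-sym R-sym new     = wen
  add-sym R-sym wen     = new

  add-irrefl : ∀ {V : Set} {R : Rel V 0ℓ} {x y} → x ≢ y →
    (∀ {v} → ¬ R v v) → ∀ {v} → ¬ AddAdj R x y v v
  add-irrefl x≢y R-irrefl (old p) = R-irrefl p
  add-irrefl x≢y R-irrefl new     = x≢y refl
  add-irrefl x≢y R-irrefl wen     = x≢y refl

  ⊤-finite : Finite ⊤
  ⊤-finite = 1 , ↔-sym 1↔⊤

Point : Graph
Point = record
  { Vertex = ⊤ ; finite = ⊤-finite ; _~_ = λ _ _ → ⊥ ; _~?_ = λ _ _ → no λ ()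
  ; ~-sym = λ () ; ~-irrefl = λ () }

infixr 5 _⊕_
_⊕_ : Graph → Graph → Graph
G ⊕ H = record
  { Vertex   = G.Vertex ⊎ H.Vertex
  ; finite   = ⊎-finite G.finite H.finite
  ; _~_      = UnionAdj G._~_ H._~_
  ; _~?_     = union? G._~?_ H._~?_
  ; ~-sym    = union-sym G.~-sym H.~-sym
  ; ~-irrefl = union-irrefl G.~-irrefl H.~-irrefl
  }
  where
  module G = Graph G
  module H = Graph H

addEdge : (G : Graph) (x y : Vertex G) → x ≢ y → Graph
addEdge G x y x≢y = record
  { Vertex   = G.Vertex
  ; finite   = G.finite
  ; _~_      = AddAdj G._~_ x y
  ; _~?_     = add? G._≟ᵛ_ G._~?_
  ; ~-sym    = add-sym G.~-sym
  ; ~-irrefl = add-irrefl x≢y G.~-irrefl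
  }
  where module G = Graph G

⊕-cong : ∀ {G′ H′} → G ≃ G′ → H ≃ H′ → G ⊕ H ≃ G′ ⊕ H′
⊕-cong φ ψ = mk≃ (Φ.bijection Sum.⊎-↔ Ψ.bijection)
  (λ { (left p) → left (Φ.hom p) ; (right p) → right (Ψ.hom p) })
  (λ { (left p) → left (Φ.back p) ; (right p) → right (Ψ.back p) })
  where
  module Φ = Iso φ
  module Ψ = Iso ψ

⊎-comm-↔ : ∀ {A B : Set} → (A ⊎ B) ↔ (B ⊎ A)
⊎-comm-↔ = mk↔ₛ′ swap swap
  (λ { (inj₁ _) → refl ; (inj₂ _) → refl }) (λ { (inj₁ _) → refl ; (inj₂ _) → refl })

⊕-comm : ∀ G H → G ⊕ H ≃ H ⊕ G
⊕-comm G H = mk≃ ⊎-comm-↔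
  (λ { (left p) → right p ; (right p) → left p })
  (λ { (left p) → right p ; (right p) → left p })

rightEdge : ∀ G {H} → Edge H → Edge (G ⊕ H)
rightEdge G e = edge (right (Edge.adjacent e))

⊕-delete : ∀ G (e : Edge H) → (G ⊕ H) - rightEdge G e ≃ G ⊕ (H - e)
⊕-delete G e = mk≃ (↔-id _)
  (λ { (left p , _) → left p
     ; (right p , ¬s) → right (p , λ s → ¬s (same-map inj₂ s)) })
  (λ { (left p) → left p , λ { (inj₁ ()) ; (inj₂ ()) }
     ; (right (p , ¬s)) → right p ,
         λ { (inj₁ (refl , refl)) → ¬s (inj₁ (refl , refl))
           ; (inj₂ (refl , refl)) → ¬s (inj₂ (refl , refl)) } })

addEdge-delete : ∀ {x y} (x≢y : x ≢ y) → ¬ G [ x ~ y ] →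
  addEdge G x y x≢y - edge new ≃ G
addEdge-delete {G} x≢y x≁y = mk≃ (↔-id _)
  (λ { (old p , _) → p
     ; (new , ¬s) → ⊥-elim (¬s (inj₁ (refl , refl)))
     ; (wen , ¬s) → ⊥-elim (¬s (inj₂ (refl , refl))) })
  (λ p → old p , λ { (inj₁ (refl , refl)) → x≁y p
                   ; (inj₂ (refl , refl)) → x≁y (Graph.~-sym G p) })

-- Rooted graphs joined by a bridge.

infix 4.5 _at_
record Rooted : Set₁ where
  constructor _at_
  field
    graph : Graph
    root  : Vertex graph
open Rooted

infix 4 _≅_
record _≅_ (X Y : Rooted) : Set where
  field
    iso    : graph X ≃ graph Y
    root-≡ : _≃_.to iso (root X) ≡ root Y
open _≅_

≅-refl : ∀ {X} → X ≅ X
≅-refl = record { iso = ≃-refl ; root-≡ = refl }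

≅-trans : ∀ {X Y Z} → X ≅ Y → Y ≅ Z → X ≅ Z
≅-trans p q = record
  { iso = ≃-trans (iso p) (iso q)
  ; root-≡ = trans (cong (_≃_.to (iso q)) (root-≡ p)) (root-≡ q) }

inj₁≢inj₂ : ∀ {A B : Set} {x : A} {y : B} → _≢_ {A = A ⊎ B} (inj₁ x) (inj₂ y)
inj₁≢inj₂ ()

join : Rooted → Rooted → Graph
join X Y = addEdge (graph X ⊕ graph Y) (inj₁ (root X)) (inj₂ (root Y)) inj₁≢inj₂

pattern inl p    = old (left p)
pattern inr p    = old (right p)
pattern bridge   = new
pattern bridge⁻¹ = wen

join-cong : ∀ {X X′ Y Y′} → X ≅ X′ → Y ≅ Y′ → join X Y ≃ join X′ Y′
join-cong {X} {X′} {Y} {Y′} φ ψ = mk≃ (Φ.bijection Sum.⊎-↔ Ψ.bijection) hom back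
  where
  module Φ = Iso (iso φ)
  module Ψ = Iso (iso ψ)
  bij = Φ.bijection Sum.⊎-↔ Ψ.bijection
  φ⁻¹ : Φ.from (root X′) ≡ root X
  φ⁻¹ = trans (cong Φ.from (sym (root-≡ φ))) (Φ.from-to _)
  ψ⁻¹ : Ψ.from (root Y′) ≡ root Y
  ψ⁻¹ = trans (cong Ψ.from (sym (root-≡ ψ))) (Ψ.from-to _)
  hom : ∀ {u v} → join X Y [ u ~ v ] → join X′ Y′ [ Inverse.to bij u ~ Inverse.to bij v ]
  hom (inl p)  = inl (Φ.hom p)
  hom (inr p)  = inr (Ψ.hom p)
  hom bridge   rewrite root-≡ φ | root-≡ ψ = bridge
  hom bridge⁻¹ rewrite root-≡ φ | root-≡ ψ = bridge⁻¹
  back : ∀ {u v} → join X′ Y′ [ u ~ v ] → join X Y [ Inverse.from bij u ~ Inverse.from bij v ]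
  back (inl p)  = inl (Φ.back p)
  back (inr p)  = inr (Ψ.back p)
  back bridge   rewrite φ⁻¹ | ψ⁻¹ = bridge
  back bridge⁻¹ rewrite φ⁻¹ | ψ⁻¹ = bridge⁻¹

join-comm : ∀ X Y → join X Y ≃ join Y X
join-comm X Y = mk≃ ⊎-comm-↔
  (λ { (inl p) → inr p ; (inr p) → inl p ; bridge → bridge⁻¹ ; bridge⁻¹ → bridge })
  (λ { (inl p) → inr p ; (inr p) → inl p ; bridge → bridge⁻¹ ; bridge⁻¹ → bridge })

inlEdge : ∀ X Y → Edge (graph X) → Edge (join X Y)
inlEdge X Y e = edge (inl (Edge.adjacent e))

inrEdge : ∀ X Y → Edge (graph Y) → Edge (join X Y)
inrEdge X Y e = edge (inr (Edge.adjacent e))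

bridgeEdge : ∀ X Y → Edge (join X Y)
bridgeEdge X Y = edge bridge

join-delete : ∀ X Y → join X Y - bridgeEdge X Y ≃ graph X ⊕ graph Y
join-delete X Y =
  addEdge-delete {graph X ⊕ graph Y} {inj₁ (root X)} {inj₂ (root Y)} inj₁≢inj₂ λ ()

point : Rooted
point = Point at tt

pendant : Rooted → Graph
pendant = join point

grow : Rooted → Rooted
grow X = pendant X at inj₁ tt

pattern top    = inj₁ tt
pattern rest u = inj₂ u

grow-cong : ∀ {X Y} → X ≅ Y → grow X ≅ grow Y
grow-cong φ = record { iso = join-cong (≅-refl {point}) φ ; root-≡ = refl }

-- The top of `grow` lies between the two roots and can be counted with either side: the bridge and
-- the stem edge at this vertex change places.
rotate : ∀ X Y → join (grow X) Y ≃ join X (grow Y)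
rotate X Y = mk≃
  (mk↔ₛ′
    (λ { (inj₁ top) → inj₂ top ; (inj₁ (rest u)) → inj₁ u ; (inj₂ v) → inj₂ (rest v) })
    (λ { (inj₁ u) → inj₁ (rest u) ; (inj₂ top) → inj₁ top ; (inj₂ (rest v)) → inj₂ v })
    (λ { (inj₁ u) → refl ; (inj₂ top) → refl ; (inj₂ (rest v)) → refl })
    (λ { (inj₁ top) → refl ; (inj₁ (rest u)) → refl ; (inj₂ v) → refl }))
  (λ { (inl (inr p)) → inl p ; (inl bridge) → bridge⁻¹ ; (inl bridge⁻¹) → bridge
     ; (inr p) → inr (inr p) ; bridge → inr bridge ; bridge⁻¹ → inr bridge⁻¹ })
  (λ { (inl p) → inl (inr p) ; bridge⁻¹ → inl bridge ; bridge → inl bridge⁻¹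
     ; (inr (inr p)) → inr p ; (inr bridge) → bridge ; (inr bridge⁻¹) → bridge⁻¹ })

-- Spiders, and the caterpillar as two of them joined.

pattern b₀ = inj₁ tt
pattern a₀ = inj₂ (inj₁ tt)
pattern c₀ = inj₂ (inj₂ tt)
pattern bc = bridge
pattern cb = bridge⁻¹
pattern ac = inr bridge
pattern ca = inr bridge⁻¹

-- B n is S(1,1,n), rooted at the end of the leg of length n (at the centre if n = 0).
cherry : Rooted
cherry = pendant (pendant point at rest tt) at c₀

B : ℕ → Rooted
B zero    = cherry
B (suc n) = grow (B n)

Spider : ℕ → Graph
Spider n = graph (B n)

-- C(2,0,...,0,2) with `m` zeros, where `m = d - 3`: the left cherry holds one end of the spine, and
-- the leg and centre of the right spider are the rest of it.
M : ℕ → Graph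
M m = join (B 0) (B m)

-- Rotating `i` times moves the bridge to the left end, so every spine edge of `M` occurs as the
-- bridge of such a join.
rotate* : ∀ i j → join (B i) (B j) ≃ M (i + j)
rotate* zero    j = ≃-refl
rotate* (suc i) j = ≃-trans (rotate (B i) (B j))
  (subst (λ k → join (B i) (B (suc j)) ≃ M k) (+-suc i j) (rotate* i (suc j)))

-- The cards of the caterpillar.

-- The card of a pendant edge, respectively of a spine edge, of C.
data Card (m : ℕ) (X : Graph) : Set where
  lone  : X ≃ Point ⊕ Spider (2 + m) → Card m X
  split : ∀ i j → i + j ≡ m → X ≃ Spider i ⊕ Spider j → Card m X

card-resp : ∀ {m X Y} → X ≃ Y → Card m Y → Card m X
card-resp φ (lone ψ)        = lone (≃-trans φ ψ)
card-resp φ (split i j s ψ) = split i j s (≃-trans φ ψ)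

card-≡ : ∀ {m n X} → m ≡ n → Card m X → Card n X
card-≡ refl c = c

-- Without `a`, the vertices `b` and `c` merely prolong the path at the root of `Y` by two.
delete-ac : ∀ Y → join cherry Y - inlEdge cherry Y (edge ac) ≃ Point ⊕ graph (grow (grow Y))
delete-ac Y = mk≃
  (mk↔ₛ′
    (λ { (inj₁ a₀) → inj₁ tt ; (inj₁ b₀) → inj₂ top
       ; (inj₁ c₀) → inj₂ (rest top) ; (inj₂ v) → inj₂ (rest (rest v)) })
    (λ { (inj₁ tt) → inj₁ a₀ ; (inj₂ top) → inj₁ b₀
       ; (inj₂ (rest top)) → inj₁ c₀ ; (inj₂ (rest (rest v))) → inj₂ v })
    (λ { (inj₁ tt) → refl ; (inj₂ top) → refl
       ; (inj₂ (rest top)) → refl ; (inj₂ (rest (rest v))) → refl })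
    (λ { (inj₁ a₀) → refl ; (inj₁ b₀) → refl
       ; (inj₁ c₀) → refl ; (inj₂ v) → refl }))
  (λ { (inl bc , _) → right bridge ; (inl cb , _) → right bridge⁻¹
     ; (inl ac , ¬s) → ⊥-elim (¬s (inj₁ (refl , refl)))
     ; (inl ca , ¬s) → ⊥-elim (¬s (inj₂ (refl , refl)))
     ; (inl (inr (inl ())) , _) ; (inl (inr (inr ())) , _)
     ; (inr p , _) → right (inr (inr p))
     ; (bridge , _) → right (inr bridge) ; (bridge⁻¹ , _) → right (inr bridge⁻¹) })
  (λ { (right bridge) → inl bc , λ { (inj₁ (() , _)) ; (inj₂ (() , _)) }
     ; (right bridge⁻¹) → inl cb , λ { (inj₁ (() , _)) ; (inj₂ (_ , ())) }
     ; (right (inr (inr p))) → inr p , λ { (inj₁ (() , _)) ; (inj₂ (() , _)) }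
     ; (right (inr bridge)) → bridge , λ { (inj₁ (() , _)) ; (inj₂ (_ , ())) }
     ; (right (inr bridge⁻¹)) → bridge⁻¹ , λ { (inj₁ (() , _)) ; (inj₂ (() , _)) } })

delete-bc : ∀ Y → join cherry Y - inlEdge cherry Y (edge bc) ≃ Point ⊕ graph (grow (grow Y))
delete-bc Y = mk≃
  (mk↔ₛ′
    (λ { (inj₁ b₀) → inj₁ tt ; (inj₁ a₀) → inj₂ top
       ; (inj₁ c₀) → inj₂ (rest top) ; (inj₂ v) → inj₂ (rest (rest v)) })
    (λ { (inj₁ tt) → inj₁ b₀ ; (inj₂ top) → inj₁ a₀
       ; (inj₂ (rest top)) → inj₁ c₀ ; (inj₂ (rest (rest v))) → inj₂ v })
    (λ { (inj₁ tt) → refl ; (inj₂ top) → refl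
       ; (inj₂ (rest top)) → refl ; (inj₂ (rest (rest v))) → refl })
    (λ { (inj₁ a₀) → refl ; (inj₁ b₀) → refl
       ; (inj₁ c₀) → refl ; (inj₂ v) → refl }))
  (λ { (inl ac , _) → right bridge ; (inl ca , _) → right bridge⁻¹
     ; (inl bc , ¬s) → ⊥-elim (¬s (inj₁ (refl , refl)))
     ; (inl cb , ¬s) → ⊥-elim (¬s (inj₂ (refl , refl)))
     ; (inl (inr (inl ())) , _) ; (inl (inr (inr ())) , _)
     ; (inr p , _) → right (inr (inr p))
     ; (bridge , _) → right (inr bridge) ; (bridge⁻¹ , _) → right (inr bridge⁻¹) })
  (λ { (right bridge) → inl ac , λ { (inj₁ (() , _)) ; (inj₂ (() , _)) }
     ; (right bridge⁻¹) → inl ca , λ { (inj₁ (() , _)) ; (inj₂ (_ , ())) }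
     ; (right (inr (inr p))) → inr p , λ { (inj₁ (() , _)) ; (inj₂ (() , _)) }
     ; (right (inr bridge)) → bridge , λ { (inj₁ (() , _)) ; (inj₂ (_ , ())) }
     ; (right (inr bridge⁻¹)) → bridge⁻¹ , λ { (inj₁ (() , _)) ; (inj₂ (() , _)) } })

join-delete⁻¹ : ∀ X Y → join X Y - reverse (bridgeEdge X Y) ≃ graph X ⊕ graph Y
join-delete⁻¹ X Y =
  ≃-trans (≃-sym (delete-reverse {join X Y} (bridgeEdge X Y))) (join-delete X Y)

delete-stem : ∀ X Y → join (grow X) Y - inlEdge (grow X) Y (edge bridge) ≃ graph X ⊕ graph (grow Y)
delete-stem X Y = ≃-trans (delete-iso (rotate X Y) (inlEdge (grow X) Y (edge bridge)))
  (join-delete⁻¹ X (grow Y))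

-- Each rotation shortens the left spider and preserves `i + j`. The edge finally turns out to be a
-- stem, which rotation makes a bridge, or a pendant edge of the left cherry.
inlCard : ∀ i j (e : Edge (Spider i)) → Card (i + j) (join (B i) (B j) - inlEdge (B i) (B j) e)
inlCard zero j (edge ac) = lone (delete-ac (B j))
inlCard zero j (edge ca) =
  lone (≃-trans (delete-reverse {join cherry (B j)} (inlEdge cherry (B j) (edge ca))) (delete-ac (B j)))
inlCard zero j (edge bc) = lone (delete-bc (B j))
inlCard zero j (edge cb) =
  lone (≃-trans (delete-reverse {join cherry (B j)} (inlEdge cherry (B j) (edge cb))) (delete-bc (B j)))
inlCard zero j (edge (inr (inl ())))
inlCard zero j (edge (inr (inr ())))
inlCard (suc i) j (edge (inr p)) = card-≡ (+-suc i j)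
  (card-resp (delete-iso (rotate (B i) (B j)) (inlEdge (grow (B i)) (B j) (edge (inr p))))
             (inlCard i (suc j) (edge p)))
inlCard (suc i) j (edge bridge) = split i (suc j) (+-suc i j) (delete-stem (B i) (B j))
inlCard (suc i) j (edge bridge⁻¹) = split i (suc j) (+-suc i j)
  (≃-trans (delete-reverse {join (grow (B i)) (B j)} (inlEdge (grow (B i)) (B j) (edge bridge⁻¹)))
           (delete-stem (B i) (B j)))

card : ∀ m (e : Edge (M m)) → Card m (M m - e)
card m (edge (inl p)) = inlCard 0 m (edge p)
card m (edge (inr p)) = card-≡ (+-identityʳ m)
  (card-resp (delete-iso (join-comm (B 0) (B m)) (inrEdge (B 0) (B m) (edge p))) (inlCard m 0 (edge p)))
card m (edge bridge)   = split 0 m refl (join-delete (B 0) (B m))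
card m (edge bridge⁻¹) = split 0 m refl (join-delete⁻¹ (B 0) (B m))

-- Edge deletion in a graph with a path grown at its root.

growEdge : ∀ X → Edge (graph X) → Edge (graph (grow X))
growEdge = inrEdge point

same-inj₂ : ∀ {A C : Set} {u v x y : C} →
  SameEnds {A ⊎ C} (inj₂ u) (inj₂ v) (inj₂ x) (inj₂ y) → SameEnds u v x y
same-inj₂ (inj₁ (refl , refl)) = inj₁ (refl , refl)
same-inj₂ (inj₂ (refl , refl)) = inj₂ (refl , refl)

grow-delete : ∀ X (e : Edge (graph X)) →
  (graph (grow X) - growEdge X e at top) ≅ grow (graph X - e at root X)
grow-delete X e = record
  { iso = mk≃ (↔-id _)
      (λ { (inr p , ¬s) → inr (p , λ s → ¬s (same-map inj₂ s))
         ; (bridge , _) → bridge ; (bridge⁻¹ , _) → bridge⁻¹ })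
      (λ { (inr (p , ¬s)) → inr p , λ s → ¬s (same-inj₂ s)
         ; bridge → bridge , λ { (inj₁ (() , _)) ; (inj₂ (() , _)) }
         ; bridge⁻¹ → bridge⁻¹ , λ { (inj₁ (_ , ())) ; (inj₂ (_ , ())) } })
  ; root-≡ = refl }

grow-⊕ : ∀ Z W →
  grow (Z ⊕ graph W at inj₂ (root W)) ≅ (Z ⊕ graph (grow W) at inj₂ top)
grow-⊕ Z W = record
  { iso = mk≃
      (mk↔ₛ′
        (λ { top → inj₂ top ; (rest (inj₁ z)) → inj₁ z ; (rest (inj₂ w)) → inj₂ (rest w) })
        (λ { (inj₁ z) → rest (inj₁ z) ; (inj₂ top) → top ; (inj₂ (rest w)) → rest (inj₂ w) })
        (λ { (inj₁ z) → refl ; (inj₂ top) → refl ; (inj₂ (rest w)) → refl })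
        (λ { top → refl ; (rest (inj₁ z)) → refl ; (rest (inj₂ w)) → refl }))
      (λ { (inr (left p)) → left p ; (inr (right p)) → right (inr p)
         ; bridge → right bridge ; bridge⁻¹ → right bridge⁻¹ })
      (λ { (left p) → inr (left p) ; (right (inr p)) → inr (right p)
         ; (right bridge) → bridge ; (right bridge⁻¹) → bridge⁻¹ })
  ; root-≡ = refl }

grow^ : ℕ → Rooted → Rooted
grow^ zero    X = X
grow^ (suc n) X = grow (grow^ n X)

growEdge^ : ∀ X n → Edge (graph X) → Edge (graph (grow^ n X))
growEdge^ X zero    e = e
growEdge^ X (suc n) e = growEdge (grow^ n X) (growEdge^ X n e)

growEdge^-injective : ∀ X n {e f : Edge (graph X)} →
  _≈_ {graph (grow^ n X)} (growEdge^ X n e) (growEdge^ X n f) → e ≈ f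
growEdge^-injective X zero    p = p
growEdge^-injective X (suc n) p = growEdge^-injective X n (same-inj₂ p)

grow^-delete : ∀ X {Y} n (e : Edge (graph X)) → (graph X - e at root X) ≅ Y →
  (graph (grow^ n X) - growEdge^ X n e at root (grow^ n X)) ≅ grow^ n Y
grow^-delete X zero    e φ = φ
grow^-delete X (suc n) e φ =
  ≅-trans (grow-delete (grow^ n X) (growEdge^ X n e)) (grow-cong (grow^-delete X n e φ))

grow^-B : ∀ n k → grow^ n (B k) ≅ B (n + k)
grow^-B zero    k = ≅-refl
grow^-B (suc n) k = grow-cong (grow^-B n k)

_⊕ᴮ_ : Graph → ℕ → Rooted
Z ⊕ᴮ k = Z ⊕ Spider k at inj₂ (root (B k))

grow^-⊕ : ∀ Z n k → grow^ n (Z ⊕ᴮ k) ≅ (Z ⊕ᴮ (n + k))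
grow^-⊕ Z zero    k = ≅-refl
grow^-⊕ Z (suc n) k = ≅-trans (grow-cong (grow^-⊕ Z n k)) (grow-⊕ Z (B (n + k)))

-- All trees of the lower bound are grown from some `X`. It suffices to compute the deletion in `X`,
-- since the path grown at the root only lengthens the leg of the component that holds the root.
grow^-splits : ∀ X Z n {k l} (e : Edge (graph X)) → n + k ≡ l →
  (graph X - e at root X) ≅ (Z ⊕ᴮ k) →
  graph (grow^ n X) - growEdge^ X n e ≃ Z ⊕ Spider l
grow^-splits X Z n e refl φ = iso (≅-trans (grow^-delete X n e φ) (grow^-⊕ Z n _))

-- Refuting two cards, and the invariant that tells the trees from C.

-- `X₁` and `X₂` are arbitrary graphs rather than deletions from `G`, so that cards can be replaced
-- by isomorphic ones before a construction is chosen.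
record Alternative (G X₁ X₂ : Graph) : Set₁ where
  field
    graph′   : Graph
    e₁ e₂    : Edge graph′
    distinct : ¬ e₁ ≈ e₂
    card₁    : graph′ - e₁ ≃ X₁
    card₂    : graph′ - e₂ ≃ X₂
    differs  : ¬ graph′ ≃ G

alternative-resp : ∀ {G X₁ X₂ Y₁ Y₂} → X₁ ≃ Y₁ → X₂ ≃ Y₂ →
  Alternative G Y₁ Y₂ → Alternative G X₁ X₂
alternative-resp φ ψ a = record
  { Alternative a
  ; card₁ = ≃-trans card₁ (≃-sym φ)
  ; card₂ = ≃-trans card₂ (≃-sym ψ) }
  where open Alternative a

alternative-swap : ∀ {G X₁ X₂} → Alternative G X₁ X₂ → Alternative G X₂ X₁
alternative-swap a = record
  { graph′ = graph′ ; e₁ = e₂ ; e₂ = e₁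
  ; distinct = distinct ∘ same-sym ; card₁ = card₂ ; card₂ = card₁ ; differs = differs }
  where open Alternative a

record Untwinned (G : Graph) : Set where
  field
    {leaf′ nbr} : Vertex G
    adjacent    : G [ leaf′ ~ nbr ]
    isLeaf      : ∀ y → G [ leaf′ ~ y ] → y ≡ nbr
    noTwin      : ∀ w → G [ nbr ~ w ] → w ≢ leaf′ → ∃[ y ] (G [ w ~ y ] × y ≢ nbr)

Twinned : Graph → Set
Twinned G = ∀ {w x} → G [ w ~ x ] → (∀ y → G [ w ~ y ] → y ≡ x) →
  ∃[ w′ ] (w′ ≢ w × G [ x ~ w′ ] × (∀ y → G [ w′ ~ y ] → y ≡ x))

-- The image of the untwinned leaf is a leaf of `H` and has a twin. Pulled back to `G`, the twin has
-- a second neighbour by `noTwin`, which contradicts that it is a leaf.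
untwinned-≄-twinned : Untwinned G → Twinned H → ¬ G ≃ H
untwinned-≄-twinned {G} {H} un tw φ =
  let w′ , w′≢w , x~w′ , w′-leaf = tw (hom adjacent)
        (λ y p → trans (sym (to-from y)) (cong to (isLeaf (from y)
          (subst (λ v → G [ v ~ from y ]) (from-to _) (back p)))))
      y , w~y , y≢x = noTwin (from w′)
        (subst (λ v → G [ v ~ from w′ ]) (from-to _) (back x~w′))
        (λ p → w′≢w (trans (sym (to-from w′)) (cong to p)))
  in y≢x (to-injective (w′-leaf _
       (subst (λ v → H [ v ~ to y ]) (to-from w′) (hom w~y))))
  where
  open Untwinned un
  open Iso φ

-- Leaves and neighbours in spiders.

aᴮ bᴮ cᴮ : ∀ n → Vertex (Spider n)
aᴮ zero    = a₀
aᴮ (suc n) = rest (aᴮ n)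
bᴮ zero    = b₀
bᴮ (suc n) = rest (bᴮ n)
cᴮ zero    = c₀
cᴮ (suc n) = rest (cᴮ n)

a-nbr : ∀ n {y} → Spider n [ aᴮ n ~ y ] → y ≡ cᴮ n
a-nbr zero          (inr (inl ()))
a-nbr zero          ac      = refl
a-nbr (suc zero)    (inr p) = cong rest (a-nbr zero p)
a-nbr (suc (suc n)) (inr p) = cong rest (a-nbr (suc n) p)

b-nbr : ∀ n {y} → Spider n [ bᴮ n ~ y ] → y ≡ cᴮ n
b-nbr zero          (inl ())
b-nbr zero          bc      = refl
b-nbr (suc zero)    (inr p) = cong rest (b-nbr zero p)
b-nbr (suc (suc n)) (inr p) = cong rest (b-nbr (suc n) p)

c~a : ∀ n → Spider n [ cᴮ n ~ aᴮ n ]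
c~a zero    = ca
c~a (suc n) = inr (c~a n)

c~b : ∀ n → Spider n [ cᴮ n ~ bᴮ n ]
c~b zero    = cb
c~b (suc n) = inr (c~b n)

a≢b : ∀ n → aᴮ n ≢ bᴮ n
a≢b zero    ()
a≢b (suc n) p = a≢b n (inj₂-injective p)

HasNeighbour : Rooted → Set
HasNeighbour X = ∃[ y ] (graph X [ root X ~ y ])

grow-hasNeighbour : ∀ X → HasNeighbour (grow X)
grow-hasNeighbour X = rest (root X) , bridge

B-hasNeighbour : ∀ n → HasNeighbour (B n)
B-hasNeighbour zero    = a₀ , ca
B-hasNeighbour (suc n) = grow-hasNeighbour (B n)

record TwoNeighbours (G : Graph) (u : Vertex G) : Set where
  constructor two
  field
    {x y} : Vertex G
    x≢y   : x ≢ y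
    u~x   : G [ u ~ x ]
    u~y   : G [ u ~ y ]

two-not-leaf : ∀ {u x} → TwoNeighbours G u → ¬ (∀ y → G [ u ~ y ] → y ≡ x)
two-not-leaf (two x≢y p q) only = x≢y (trans (only _ p) (sym (only _ q)))

-- The root is a class of its own because its degree changes when the spider is grown or joined at
-- it.
data Kind (n : ℕ) : Vertex (Spider n) → Set where
  isA    : Kind n (aᴮ n)
  isB    : Kind n (bᴮ n)
  isRoot : Kind n (root (B n))
  inner  : ∀ {u} → TwoNeighbours (Spider n) u → Kind n u

inr-two : ∀ {X Y u} → TwoNeighbours (graph Y) u → TwoNeighbours (join X Y) (inj₂ u)
inr-two (two x≢y p q) = two (x≢y ∘ inj₂-injective) (inr p) (inr q)

kind : ∀ n u → Kind n u
kind zero    a₀ = isA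
kind zero    b₀ = isB
kind zero    c₀ = isRoot
kind (suc n) top = isRoot
kind (suc n) (rest u) with kind n u
... | isA     = isA
... | isB     = isB
-- After growing, the former root has the new vertex as a second neighbour.
... | isRoot  = inner (two {x = top} (λ ()) bridge⁻¹ (inr (proj₂ (B-hasNeighbour n))))
... | inner t = inner (inr-two {point} {B n} t)

-- The only leaves are the two pairs `a`, `b`. Every other vertex has two neighbours, the root of
-- the right spider thanks to the bridge.
M-twinned : ∀ m → Twinned (M (suc m))
M-twinned m {inj₁ a₀} _ only with refl ← only _ (inl ac) =
  inj₁ b₀ , (λ ()) , inl cb , λ { _ (inl bc) → refl ; _ (inl (inl ())) }
M-twinned m {inj₁ b₀} _ only with refl ← only _ (inl bc) =
  inj₁ a₀ , (λ ()) , inl ca , λ { _ (inl ac) → refl ; _ (inl (inr (inl ()))) }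
M-twinned m {inj₁ c₀} _ only =
  ⊥-elim (two-not-leaf {M (suc m)} (two {x = inj₁ a₀} {inj₁ b₀} (λ ()) (inl ca) (inl cb)) only)
M-twinned m {inj₂ u} _ only with kind (suc m) u
... | isRoot = ⊥-elim (two-not-leaf {M (suc m)}
        (two {x = inj₁ c₀} (λ ()) bridge⁻¹ (inr bridge)) only)
... | inner t = ⊥-elim (two-not-leaf {M (suc m)} (inr-two {B 0} {B (suc m)} t) only)
... | isA with refl ← only _ (inr (Graph.~-sym (Spider (suc m)) (c~a (suc m)))) =
  inj₂ (bᴮ (suc m)) , (λ p → a≢b (suc m) (sym (inj₂-injective p)))
  , inr (c~b (suc m)) , λ { _ (inr p) → cong inj₂ (b-nbr (suc m) p) }
... | isB with refl ← only _ (inr (Graph.~-sym (Spider (suc m)) (c~b (suc m)))) =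
  inj₂ (aᴮ (suc m)) , (λ p → a≢b (suc m) (inj₂-injective p))
  , inr (c~a (suc m)) , λ { _ (inr p) → cong inj₂ (a-nbr (suc m) p) }

NonleafNeighbours : Rooted → Set
NonleafNeighbours X =
  ∀ {y} → graph X [ root X ~ y ] → ∃[ y′ ] (graph X [ y ~ y′ ] × y′ ≢ root X)

grow-untwinned : ∀ X → NonleafNeighbours X → Untwinned (graph (grow X))
grow-untwinned X nl = record
  { leaf′ = top ; nbr = rest (root X) ; adjacent = bridge
  ; isLeaf = λ { _ bridge → refl ; _ (inl ()) }
  ; noTwin = λ where
      _ (inr p) _ → let y , q , y≢ = nl p in rest y , inr q , y≢ ∘ inj₂-injective
      _ bridge⁻¹ top≢top → ⊥-elim (top≢top refl) }

grow-nonleaf : ∀ X → HasNeighbour X → NonleafNeighbours (grow X)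
grow-nonleaf X (z , p) (inl ())
grow-nonleaf X (z , p) bridge = rest z , inr p , λ ()

grow^-hasNeighbour : ∀ n X → HasNeighbour X → HasNeighbour (grow^ n X)
grow^-hasNeighbour zero    X h = h
grow^-hasNeighbour (suc n) X h = grow-hasNeighbour (grow^ n X)

-- The tip is a leaf, and the only other neighbour of its neighbour is the root of `grow^ n X`,
-- which has a neighbour of its own there.
grow^-untwinned : ∀ n X → HasNeighbour X → Untwinned (graph (grow^ (2 + n) X))
grow^-untwinned n X h =
  grow-untwinned (grow^ (suc n) X) (grow-nonleaf (grow^ n X) (grow^-hasNeighbour n X h))

-- Alternatives for two pendant cards.

-- The claw rooted at its centre, so that `grow^ n star` is S(1,1,1,n).
star : Rooted
star = pendant (pendant (pendant point at rest tt) at c₀) at rest c₀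

-- Exchanging the leaves `top` and `a` carries one deleted edge of the next construction to the
-- other, so that one card need not be computed.
star-swap : graph star ≃ graph star
star-swap = mk≃ (mk↔ₛ′ σ σ σσ σσ) σ-hom σ-hom
  where
  σ : Vertex (graph star) → Vertex (graph star)
  σ top       = rest a₀
  σ (rest a₀) = top
  σ (rest b₀) = rest b₀
  σ (rest c₀) = rest c₀
  σσ : ∀ v → σ (σ v) ≡ v
  σσ top       = refl
  σσ (rest a₀) = refl
  σσ (rest b₀) = refl
  σσ (rest c₀) = refl
  σ-hom : ∀ {u v} → graph star [ u ~ v ] → graph star [ σ u ~ σ v ]
  σ-hom (inl ())
  σ-hom (inr (inl ()))
  σ-hom (inr (inr (inl ())))
  σ-hom (inr (inr (inr ())))
  σ-hom bridge   = inr ac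
  σ-hom bridge⁻¹ = inr ca
  σ-hom (inr ac) = bridge
  σ-hom (inr ca) = bridge⁻¹
  σ-hom (inr bc) = inr bc
  σ-hom (inr cb) = inr cb

alternative-lone-lone : ∀ m →
  Alternative (M (suc m)) (Point ⊕ Spider (3 + m)) (Point ⊕ Spider (3 + m))
alternative-lone-lone m = record
  { graph′ = graph (grow^ (3 + m) star)
  ; e₁ = growEdge^ star (3 + m) e₁ ; e₂ = growEdge^ star (3 + m) e₂
  ; distinct = λ s → e₁≉e₂ (growEdge^-injective star (3 + m) {e₁} {e₂} s)
  ; card₁ = grow^-splits star Point (3 + m) e₁ (+-identityʳ _) split₁
  ; card₂ = grow^-splits star Point (3 + m) e₂ (+-identityʳ _) split₂
  ; differs = untwinned-≄-twinned (grow^-untwinned (suc m) star (top , bridge⁻¹)) (M-twinned m)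
  }
  where
  e₁ e₂ : Edge (graph star)
  e₁ = edge bridge
  e₂ = edge (inr ac)
  e₁≉e₂ : ¬ e₁ ≈ e₂
  e₁≉e₂ (inj₁ (() , _))
  e₁≉e₂ (inj₂ (() , _))
  split₁ : (graph star - e₁ at root star) ≅ (Point ⊕ᴮ 0)
  split₁ = record { iso = join-delete point cherry ; root-≡ = refl }
  split₂ : (graph star - e₂ at root star) ≅ (Point ⊕ᴮ 0)
  split₂ = record { iso = ≃-trans (delete-iso star-swap e₂) (iso split₁) ; root-≡ = refl }

-- Alternatives for a pendant card and a spine card.

-- The three vertices cut off form a path, which is a cherry centred at its middle vertex.
delete-rest-stem : ∀ X → graph (grow (grow (grow X))) - edge (inr (inr bridge)) ≃ graph X ⊕ graph cherry
delete-rest-stem X = mk≃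
  (mk↔ₛ′
    (λ { top → inj₂ b₀ ; (rest top) → inj₂ c₀
       ; (rest (rest top)) → inj₂ a₀ ; (rest (rest (rest u))) → inj₁ u })
    (λ { (inj₂ b₀) → top ; (inj₂ c₀) → rest top
       ; (inj₂ a₀) → rest (rest top) ; (inj₁ u) → rest (rest (rest u)) })
    (λ { (inj₂ b₀) → refl ; (inj₂ c₀) → refl ; (inj₂ a₀) → refl ; (inj₁ u) → refl })
    (λ { top → refl ; (rest top) → refl
       ; (rest (rest top)) → refl ; (rest (rest (rest u))) → refl }))
  (λ { (inl () , _) ; (inr (inl ()) , _) ; (inr (inr (inl ())) , _)
     ; (bridge , _) → right bc ; (bridge⁻¹ , _) → right cb
     ; (inr bridge , _) → right ca ; (inr bridge⁻¹ , _) → right ac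
     ; (inr (inr bridge) , ¬s) → ⊥-elim (¬s (inj₁ (refl , refl)))
     ; (inr (inr bridge⁻¹) , ¬s) → ⊥-elim (¬s (inj₂ (refl , refl)))
     ; (inr (inr (inr p)) , _) → left p })
  (λ { (right (inl ())) ; (right (inr (inl ()))) ; (right (inr (inr ())))
     ; (right bc) → bridge , λ { (inj₁ (() , _)) ; (inj₂ (() , _)) }
     ; (right cb) → bridge⁻¹ , λ { (inj₁ (() , _)) ; (inj₂ (() , _)) }
     ; (right ca) → inr bridge , λ { (inj₁ (() , _)) ; (inj₂ (() , _)) }
     ; (right ac) → inr bridge⁻¹ , λ { (inj₁ (_ , ())) ; (inj₂ (() , _)) }
     ; (left p) → inr (inr (inr p)) , λ { (inj₁ (() , _)) ; (inj₂ (_ , ())) } })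

-- A branch of length `j` is grown at the vertex next to the end of the long leg of S(1,1,i+3).
-- Deleting the pendant edge at that end joins branch and leg into one leg; the other deletion
-- leaves S(1,1,i), and a cherry whose centre carries the branch. For `j = 1` the end of the leg and
-- the branch would be twins and the tree would be C.
alternative-lone-split-≢1 : ∀ m i j → i + j ≡ suc m → j ≢ 1 →
  Alternative (M (suc m)) (Point ⊕ Spider (3 + m)) (Spider i ⊕ Spider j)
alternative-lone-split-≢1 m i j i+j≡m j≢1 = record
  { graph′ = graph (grow^ j X)
  ; e₁ = growEdge^ X j e₁ ; e₂ = growEdge^ X j e₂
  ; distinct = λ s → e₁≉e₂ (growEdge^-injective X j {e₁} {e₂} s)
  ; card₁ = grow^-splits X Point j e₁
      (trans (+-comm j (2 + i)) (cong (2 +_) i+j≡m))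
      (record { iso = join-delete point (B (2 + i)) ; root-≡ = refl })
  ; card₂ = grow^-splits X (Spider i) j e₂ (+-identityʳ j)
      (record { iso = delete-rest-stem (B i) ; root-≡ = refl })
  ; differs = untwinned-≄-twinned (untwinned j j≢1) (M-twinned m)
  }
  where
  X : Rooted
  X = Spider (3 + i) at rest top
  e₁ e₂ : Edge (Spider (3 + i))
  e₁ = edge bridge
  e₂ = edge (inr (inr bridge))
  e₁≉e₂ : ¬ e₁ ≈ e₂
  e₁≉e₂ (inj₁ (() , _))
  e₁≉e₂ (inj₂ (() , _))
  untwinned : ∀ j → j ≢ 1 → Untwinned (graph (grow^ j X))
  -- Without a branch the untwinned leaf is the end of the long leg, otherwise the end of the
  -- branch.
  untwinned zero          _   = grow^-untwinned 0 (B (suc i)) (B-hasNeighbour (suc i))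
  untwinned (suc zero)    j≢1 = ⊥-elim (j≢1 refl)
  untwinned (suc (suc j)) _   = grow^-untwinned j X (top , bridge⁻¹)

-- Alternatives for two spine cards.

-- The top of `grow Y` stays attached to `X` by the bridge, and now prolongs `X` instead of `Y`.
delete-inr-stem : ∀ X Y → join X (grow Y) - edge (inr bridge) ≃ graph Y ⊕ graph (grow X)
delete-inr-stem X Y = mk≃
  (mk↔ₛ′
    (λ { (inj₁ u) → inj₂ (rest u) ; (inj₂ top) → inj₂ top ; (inj₂ (rest v)) → inj₁ v })
    (λ { (inj₂ (rest u)) → inj₁ u ; (inj₂ top) → inj₂ top ; (inj₁ v) → inj₂ (rest v) })
    (λ { (inj₂ (rest u)) → refl ; (inj₂ top) → refl ; (inj₁ v) → refl })
    (λ { (inj₁ u) → refl ; (inj₂ top) → refl ; (inj₂ (rest v)) → refl }))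
  (λ { (inl p , _) → right (inr p) ; (bridge , _) → right bridge⁻¹
     ; (bridge⁻¹ , _) → right bridge ; (inr (inl ()) , _)
     ; (inr bridge , ¬s) → ⊥-elim (¬s (inj₁ (refl , refl)))
     ; (inr bridge⁻¹ , ¬s) → ⊥-elim (¬s (inj₂ (refl , refl)))
     ; (inr (inr p) , _) → left p })
  (λ { (right (inl ()))
     ; (right (inr p)) → inl p , λ { (inj₁ (() , _)) ; (inj₂ (() , _)) }
     ; (right bridge) → bridge⁻¹ , λ { (inj₁ (_ , ())) ; (inj₂ (() , _)) }
     ; (right bridge⁻¹) → bridge , λ { (inj₁ (() , _)) ; (inj₂ (() , _)) }
     ; (left p) → inr (inr p) , λ { (inj₁ (() , _)) ; (inj₂ (_ , ())) } })

-- The tails of S(1,1,i) and S(1,1,k) and a path of `n + 1` vertices meet in the root of `X`.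
-- Cutting off one spider leaves the other with its leg prolonged by the root and the path. The end
-- of the path is the untwinned leaf.
alternative-split-split : ∀ m i k n {j l} → suc n + suc k ≡ j → suc n + suc i ≡ l →
  Alternative (M (suc m)) (Spider i ⊕ Spider j) (Spider k ⊕ Spider l)
alternative-split-split m i k n j≡ l≡ = record
  { graph′ = graph (grow^ (suc n) X)
  ; e₁ = growEdge^ X (suc n) e₁ ; e₂ = growEdge^ X (suc n) e₂
  ; distinct = λ s → e₁≉e₂ (growEdge^-injective X (suc n) {e₁} {e₂} s)
  ; card₁ = grow^-splits X (Spider i) (suc n) e₁ j≡
      (record { iso = join-delete (B i) (B (suc k)) ; root-≡ = refl })
  ; card₂ = grow^-splits X (Spider k) (suc n) e₂ l≡
      (record { iso = delete-inr-stem (B i) (B k) ; root-≡ = refl })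
  ; differs = untwinned-≄-twinned (grow-untwinned (grow^ n X) (nonleaf n)) (M-twinned m)
  }
  where
  X : Rooted
  X = join (B i) (B (suc k)) at inj₂ top
  e₁ e₂ : Edge (graph X)
  e₁ = bridgeEdge (B i) (B (suc k))
  e₂ = edge (inr bridge)
  e₁≉e₂ : ¬ e₁ ≈ e₂
  e₁≉e₂ (inj₁ (() , _))
  e₁≉e₂ (inj₂ (() , _))
  nonleaf : ∀ n → NonleafNeighbours (grow^ n X)
  -- If the path has one vertex, its neighbour is the meeting vertex, whose other neighbours are the
  -- roots of the two spiders.
  nonleaf zero (inr (inl ()))
  nonleaf zero (inr bridge) = let y , p = B-hasNeighbour k in inj₂ (rest y) , inr (inr p) , λ ()
  nonleaf zero bridge⁻¹     = let y , p = B-hasNeighbour i in inj₁ y , inl p , λ ()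
  nonleaf (suc n) = grow-nonleaf (grow^ n X)
    (grow^-hasNeighbour n X (inj₂ (rest (root (B k))) , inr bridge))

-- Disconnected alternatives for two equal middle cards.

-- This form of connectedness avoids walks: a disjoint union refutes it with the colouring by
-- summands.
Connected : Graph → Set
Connected G = (χ : Vertex G → Bool) → (∀ {u v} → G [ u ~ v ] → χ u ≡ χ v) → ∀ u v → χ u ≡ χ v

connected-resp : G ≃ H → Connected H → Connected G
connected-resp φ conn χ inv u v =
  subst₂ (λ x y → χ x ≡ χ y) (from-to u) (from-to v)
    (conn (χ ∘ from) (λ p → inv (back p)) (to u) (to v))
  where open Iso φ

join-connected : ∀ X Y → Connected (graph X) → Connected (graph Y) → Connected (join X Y)
join-connected X Y conn-X conn-Y χ inv = all
  where
  x = conn-X (χ ∘ inj₁) (λ p → inv (inl p))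
  y = conn-Y (χ ∘ inj₂) (λ p → inv (inr p))
  x-y : ∀ u v → χ (inj₁ u) ≡ χ (inj₂ v)
  x-y u v = trans (x u (root X)) (trans (inv bridge) (y (root Y) v))
  all : ∀ u v → χ u ≡ χ v
  all (inj₁ u) (inj₁ v) = x u v
  all (inj₁ u) (inj₂ v) = x-y u v
  all (inj₂ u) (inj₁ v) = sym (x-y v u)
  all (inj₂ u) (inj₂ v) = y u v

point-connected : Connected Point
point-connected χ _ tt tt = refl

B-connected : ∀ n → Connected (Spider n)
B-connected zero = join-connected point (pendant point at rest tt) point-connected
  (join-connected point point point-connected point-connected)
B-connected (suc n) = join-connected point (B n) point-connected (B-connected n)

⊕-disconnected : Vertex G → Vertex H → ¬ Connected (G ⊕ H)
⊕-disconnected u v conn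
  with () ← conn (λ { (inj₁ _) → true ; (inj₂ _) → false })
                 (λ { (left _) → refl ; (right _) → refl }) (inj₁ u) (inj₂ v)

-- In the applications `G` contains a cycle, two of whose edges give the same spider when deleted.
-- The spare component makes the graph disconnected, unlike `M m`.
alternative-disconnected : ∀ m i k (e f : Edge G) → ¬ e ≈ f →
  G - e ≃ Spider k → G - f ≃ Spider k →
  Alternative (M m) (Spider i ⊕ Spider k) (Spider i ⊕ Spider k)
alternative-disconnected {G} m i k e f e≉f φ ψ = record
  { graph′ = Spider i ⊕ G
  ; e₁ = rightEdge (Spider i) e ; e₂ = rightEdge (Spider i) f
  ; distinct = λ s → e≉f (same-inj₂ s)
  ; card₁ = ≃-trans (⊕-delete (Spider i) e) (⊕-cong (≃-refl {Spider i}) φ)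
  ; card₂ = ≃-trans (⊕-delete (Spider i) f) (⊕-cong (≃-refl {Spider i}) ψ)
  ; differs = λ θ → ⊕-disconnected {Spider i} {G} (root (B i)) (Edge.source e)
      (connected-resp θ (join-connected (B 0) (B m) (B-connected 0) (B-connected m)))
  }

triangle : Graph
triangle = addEdge (Spider 0) a₀ b₀ λ ()

-- Exchanging `b` and `c` carries the edge `ac` to the added edge.
triangle-rotate : triangle ≃ triangle
triangle-rotate = mk≃ (mk↔ₛ′ σ σ σσ σσ) σ-hom σ-hom
  where
  σ : Vertex triangle → Vertex triangle
  σ a₀ = a₀
  σ b₀ = c₀
  σ c₀ = b₀
  σσ : ∀ v → σ (σ v) ≡ v
  σσ a₀ = refl
  σσ b₀ = refl
  σσ c₀ = refl
  σ-hom : ∀ {u v} → triangle [ u ~ v ] → triangle [ σ u ~ σ v ]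
  σ-hom (old (inl ()))
  σ-hom (old (inr (inl ())))
  σ-hom (old (inr (inr ())))
  σ-hom (old ac) = new
  σ-hom (old ca) = wen
  σ-hom (old bc) = old cb
  σ-hom (old cb) = old bc
  σ-hom new      = old ac
  σ-hom wen      = old ca

-- A 4-cycle with a pendant vertex b and, at the opposite vertex, the root.
kite : Rooted
kite = addEdge (Spider 2) top (rest (rest a₀)) (λ ()) at top

-- The reflection of the 4-cycle that fixes the root and the centre `c`; it carries the other cycle
-- edge at the root to the added edge.
kite-swap : graph kite ≃ graph kite
kite-swap = mk≃ (mk↔ₛ′ σ σ σσ σσ) σ-hom σ-hom
  where
  σ : Vertex (graph kite) → Vertex (graph kite)
  σ top              = top
  σ (rest top)       = rest (rest a₀)
  σ (rest (rest a₀)) = rest top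
  σ (rest (rest b₀)) = rest (rest b₀)
  σ (rest (rest c₀)) = rest (rest c₀)
  σσ : ∀ v → σ (σ v) ≡ v
  σσ top              = refl
  σσ (rest top)       = refl
  σσ (rest (rest a₀)) = refl
  σσ (rest (rest b₀)) = refl
  σσ (rest (rest c₀)) = refl
  σ-hom : ∀ {u v} → graph kite [ u ~ v ] → graph kite [ σ u ~ σ v ]
  σ-hom (old (inl ()))
  σ-hom (old (inr (inl ())))
  σ-hom (old (inr (inr (inl ()))))
  σ-hom (old (inr (inr (inr (inl ())))))
  σ-hom (old (inr (inr (inr (inr ())))))
  σ-hom (old bridge)         = new
  σ-hom (old bridge⁻¹)       = wen
  σ-hom new                  = old bridge
  σ-hom wen                  = old bridge⁻¹
  σ-hom (old (inr bridge))   = old (inr (inr ac))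
  σ-hom (old (inr bridge⁻¹)) = old (inr (inr ca))
  σ-hom (old (inr (inr ac))) = old (inr bridge)
  σ-hom (old (inr (inr ca))) = old (inr bridge⁻¹)
  σ-hom (old (inr (inr bc))) = old (inr (inr bc))
  σ-hom (old (inr (inr cb))) = old (inr (inr cb))

-- The 4-cycle needs a leg of length at least 2 and is put into the larger component. For `t = 0`
-- neither leg is that long, and a triangle on the smaller component takes its place.
alternative-middle : ∀ t m →
  Alternative (M m) (Spider t ⊕ Spider (suc t)) (Spider t ⊕ Spider (suc t))
alternative-middle zero m = alternative-resp (⊕-comm (Spider 0) (Spider 1)) (⊕-comm (Spider 0) (Spider 1))
  (alternative-disconnected m 1 0 e₁ e₂ e₁≉e₂ φ (≃-trans (delete-iso triangle-rotate e₂) φ))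
  where
  e₁ e₂ : Edge triangle
  e₁ = edge new
  e₂ = edge (old ac)
  e₁≉e₂ : ¬ e₁ ≈ e₂
  e₁≉e₂ (inj₁ (_ , ()))
  e₁≉e₂ (inj₂ (() , _))
  φ : triangle - e₁ ≃ Spider 0
  φ = addEdge-delete {Spider 0} {a₀} {b₀} (λ ()) λ { (old ()) }
alternative-middle (suc t) m =
  alternative-disconnected m (suc t) (2 + t)
    (growEdge^ kite t e₁) (growEdge^ kite t e₂)
    (λ s → e₁≉e₂ (growEdge^-injective kite t {e₁} {e₂} s))
    (grown e₁ φ) (grown e₂ (record { iso = ≃-trans (delete-iso kite-swap e₂) (iso φ) ; root-≡ = refl }))
  where
  e₁ e₂ : Edge (graph kite)
  e₁ = edge new
  e₂ = edge (old bridge)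
  e₁≉e₂ : ¬ e₁ ≈ e₂
  e₁≉e₂ (inj₁ (_ , ()))
  e₁≉e₂ (inj₂ (() , _))
  φ : (graph kite - e₁ at root kite) ≅ B 2
  φ = record
    { iso = addEdge-delete {Spider 2} {top} {rest (rest a₀)} (λ ()) λ { (old ()) }
    ; root-≡ = refl }
  grown : ∀ e → (graph kite - e at root kite) ≅ B 2 →
    graph (grow^ t kite) - growEdge^ kite t e ≃ Spider (2 + t)
  grown e ψ = subst (λ n → graph (grow^ t kite) - growEdge^ kite t e ≃ Spider n) (+-comm t 2)
    (iso (≅-trans (grow^-delete kite t e ψ) (grow^-B t 2)))

-- Combining the constructions: fewer than three cards never suffice.

-- Normal form of a spine card for `m = 2t + 1`: `i` is the smaller part and `p = t - i` its
-- distance from the middle, so the larger part `m - i` is `p + suc t`.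
record Half (t : ℕ) (X : Graph) : Set where
  constructor half
  field
    i p   : ℕ
    i+p≡t : i + p ≡ t
    shape : X ≃ Spider i ⊕ Spider (p + suc t)

split-half : ∀ t i j {X} → i + j ≡ suc (t + t) → X ≃ Spider i ⊕ Spider j → Half t X
split-half t i j {X} sum φ with i ≤? t
... | yes i≤t with p , refl ← m≤n⇒∃[o]m+o≡n i≤t =
  half i p refl (subst (λ l → X ≃ Spider i ⊕ Spider l) (+-cancelˡ-≡ i j _ (begin
    i + j                 ≡⟨ sum ⟩
    suc ((i + p) + (i + p)) ≡⟨ +-suc (i + p) (i + p) ⟨
    (i + p) + suc (i + p) ≡⟨ +-assoc i p _ ⟩
    i + (p + suc (i + p)) ∎)) φ)
  where open ≡-Reasoning
-- Here `j` is the smaller part, and the two components are exchanged.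
... | no i≰t with o , refl ← m≤n⇒∃[o]m+o≡n (≰⇒> i≰t) =
  half j o (trans (+-comm j o) (+-cancelˡ-≡ (suc t) _ _ (trans (sym (+-assoc (suc t) o j)) sum)))
    (≃-trans φ (≃-trans (⊕-comm (Spider (suc t + o)) (Spider j))
      (subst (λ l → Spider j ⊕ Spider (suc t + o) ≃ Spider j ⊕ Spider l) (+-comm (suc t) o) ≃-refl)))

t+t≢1 : ∀ t → t + t ≢ 1
t+t≢1 (suc t) p with () ← trans (sym (+-suc t t)) (suc-injective p)

halves-sum : ∀ p q k → p + q + suc k ≡ p + suc (k + q)
halves-sum p q k = trans (+-assoc p q (suc k)) (cong (p +_) (+-comm q (suc k)))

-- The third path gets `p + q` vertices: as `k + q ≡ t`, it prolongs the tail `k` together with the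
-- meeting vertex to `p + suc t`, and symmetrically for `i`. If `p + q` is zero, both cards are the
-- middle one and no path is left.
alternative-halves : ∀ t {X₁ X₂} → Half t X₁ → Half t X₂ → Alternative (M (suc (t + t))) X₁ X₂
alternative-halves t (half i p i+p≡t φ) (half k q k+q≡t ψ) =
  alternative-resp φ ψ (cases p q i+p≡t k+q≡t)
  where
  cases : ∀ p q → i + p ≡ t → k + q ≡ t → Alternative (M (suc (t + t)))
    (Spider i ⊕ Spider (p + suc t)) (Spider k ⊕ Spider (q + suc t))
  unequal : ∀ p q n → suc n ≡ p + q → i + p ≡ t → k + q ≡ t → Alternative (M (suc (t + t)))
    (Spider i ⊕ Spider (p + suc t)) (Spider k ⊕ Spider (q + suc t))
  unequal p q n n≡ i+p≡t k+q≡t = alternative-split-split (t + t) i k n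
    (trans (cong (_+ suc k) n≡)
      (trans (halves-sum p q k) (cong (λ s → p + suc s) k+q≡t)))
    (trans (cong (_+ suc i) (trans n≡ (+-comm p q)))
      (trans (halves-sum q p i) (cong (λ s → q + suc s) i+p≡t)))
  cases (suc p) q       e f = unequal (suc p) q (p + q) refl e f
  cases zero    (suc q) e f = unequal zero (suc q) q refl e f
  cases zero    zero    e f
    with refl ← trans (sym (+-identityʳ i)) e | refl ← trans (sym (+-identityʳ k)) f =
    alternative-middle t (suc (t + t))

alternative : ∀ t {X₁ X₂} → Card (suc (t + t)) X₁ → Card (suc (t + t)) X₂ →
  Alternative (M (suc (t + t))) X₁ X₂
-- The excluded case `j = 1` is avoided by exchanging the components: the other one is then
-- S(1,1,2t), and `2t` is not 1. Here the parity of `m` enters.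
alternative-lone-split : ∀ t {X₁ X₂} → X₁ ≃ Point ⊕ Spider (3 + (t + t)) →
  ∀ i j → i + j ≡ suc (t + t) → X₂ ≃ Spider i ⊕ Spider j → Alternative (M (suc (t + t))) X₁ X₂
alternative-lone-split t φ i j sum ψ with j ≟ 1
... | no j≢1 = alternative-resp φ ψ (alternative-lone-split-≢1 (t + t) i j sum j≢1)
... | yes refl = alternative-resp φ (≃-trans ψ (⊕-comm (Spider i) (Spider 1)))
  (alternative-lone-split-≢1 (t + t) 1 i (trans (+-comm 1 i) sum) λ { refl → t+t≢1 t (sym (suc-injective sum)) })
alternative t (lone φ) (lone ψ) = alternative-resp φ ψ (alternative-lone-lone (t + t))
alternative t (lone φ) (split i j sum ψ) = alternative-lone-split t φ i j sum ψ
alternative t (split i j sum φ) (lone ψ) = alternative-swap (alternative-lone-split t ψ i j sum φ)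
alternative t (split i j sum φ) (split k l sum′ ψ) =
  alternative-halves t (split-half t i j sum φ) (split-half t k l sum′ ψ)

-- The constructions also apply to an edge paired with itself, and such a pair settles the cases of
-- no card and of one card.
≥3-cards : ∀ t → G ≃ M (suc (t + t)) → ∀ j → ReconstructibleFrom G j → 3 ≤ j
≥3-cards {G} t φ j (e , _ , reconstruct) = bound j e reconstruct
  where
  alt : (e f : Edge G) → Alternative G (G - e) (G - f)
  alt e f = record { Alternative a ; differs = λ θ → Alternative.differs a (≃-trans θ φ) }
    where
    cardᴳ : (e : Edge G) → Card (suc (t + t)) (G - e)
    cardᴳ e = card-resp (delete-iso φ e) (card _ (mapEdge φ e))
    a = alternative t (cardᴳ e) (cardᴳ f)
  bound : ∀ j (e : Fin j → Edge G) → Reconstruct G e → 3 ≤ j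
  bound 0 e rec = ⊥-elim (differs (rec graph′ (λ ()) (λ { {()} }) λ ()))
    where
    leafEdge = mapEdge (≃-sym φ) (inlEdge (B 0) (B (suc (t + t))) (edge ac))
    open Alternative (alt leafEdge leafEdge)
  bound 1 e rec = ⊥-elim (differs (rec graph′ (λ _ → e₁) (λ { {zero} {zero} _ → refl })
                                       λ { zero → card₁ }))
    where open Alternative (alt (e zero) (e zero))
  bound 2 e rec = ⊥-elim (differs (rec graph′ f f-distinct λ { zero → card₁ ; (suc zero) → card₂ }))
    where
    open Alternative (alt (e zero) (e (suc zero)))
    f : Fin 2 → Edge graph′
    f zero       = e₁
    f (suc zero) = e₂
    f-distinct : Distinct f
    f-distinct {zero}     {zero}     _ = refl
    f-distinct {zero}     {suc zero} s = ⊥-elim (distinct s)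
    f-distinct {suc zero} {zero}     s = ⊥-elim (distinct (same-sym s))
    f-distinct {suc zero} {suc zero} _ = refl
  bound (suc (suc (suc j))) _ _ = s≤s (s≤s (s≤s z≤n))

-- Recovery of a graph from a card with an isolated vertex.

NoIsolated : Graph → Set
NoIsolated G = ∀ u → ∃[ v ] (G [ u ~ v ])

noIsolated-resp : G ≃ H → NoIsolated H → NoIsolated G
noIsolated-resp {G} φ ni u =
  let v , p = ni (to u) in from v , subst (λ x → G [ x ~ from v ]) (from-to u) (back p)
  where open Iso φ

spider-noIsolated : ∀ n → NoIsolated (Spider n)
spider-noIsolated n u with kind n u
... | isA    = cᴮ n , Graph.~-sym (Spider n) (c~a n)
... | isB    = cᴮ n , Graph.~-sym (Spider n) (c~b n)
... | isRoot = B-hasNeighbour n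
... | inner (two {x} _ p _) = x , p

⊕-noIsolated : NoIsolated G → NoIsolated H → NoIsolated (G ⊕ H)
⊕-noIsolated g h (inj₁ u) = let v , p = g u in inj₁ v , left p
⊕-noIsolated g h (inj₂ u) = let v , p = h u in inj₂ v , right p

-- The isolated vertex `z` of the card has a neighbour `y` in `H`, so the deleted edge is `zy`, and
-- putting it back attaches `z` to `K` as a pendant vertex.
reattach : ∀ {H K} (f : Edge H) → H - f ≃ Point ⊕ K → NoIsolated H →
  ∃[ p ] (H ≃ pendant (K at p))
reattach {H} {K} f φ ni = attached (to y) refl
  where
  open Iso φ
  open Edge f using (source; target)
  z y : Vertex H
  z = from (inj₁ tt)
  y = proj₁ (ni z)
  isolated : ∀ {w} → ¬ (Point ⊕ K) [ inj₁ tt ~ w ]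
  isolated (left ())
  z-y : SameEnds z y source target
  z-y with same? H z y source target
  ... | yes s = s
  ... | no ¬s = ⊥-elim (isolated
    (subst (λ v → (Point ⊕ K) [ v ~ to y ]) (to-from (inj₁ tt)) (hom (proj₂ (ni z) , ¬s))))
  -- The image of `y` lies in `K`, because the isolated point corresponds to `z` and `z` is not
  -- adjacent to itself.
  attached : ∀ w → to y ≡ w → ∃[ p ] (H ≃ pendant (K at p))
  attached (inj₁ tt) eq = ⊥-elim (Graph.~-irrefl H
    (subst (λ v → H [ z ~ v ]) (to-injective (trans eq (sym (to-from (inj₁ tt))))) (proj₂ (ni z))))
  attached (inj₂ p) to-y = p , mk≃ bijection hom′ back′
    where
    from-p : from (inj₂ p) ≡ y
    from-p = trans (cong from (sym to-y)) (from-to y)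
    hom′ : ∀ {u v} → H [ u ~ v ] → pendant (K at p) [ to u ~ to v ]
    hom′ {u} {v} q with same? H u v source target
    ... | no ¬s = old (hom (q , ¬s))
    ... | yes s with same-trans s (same-sym z-y)
    ... | inj₁ (refl , refl) = subst₂ (pendant (K at p) [_~_]) (sym (to-from (inj₁ tt))) (sym to-y) bridge
    ... | inj₂ (refl , refl) = subst₂ (pendant (K at p) [_~_]) (sym to-y) (sym (to-from (inj₁ tt))) bridge⁻¹
    back′ : ∀ {u v} → pendant (K at p) [ u ~ v ] → H [ from u ~ from v ]
    back′ (old q)  = proj₁ (back q)
    back′ bridge   rewrite from-p = proj₂ (ni z)
    back′ bridge⁻¹ rewrite from-p = Graph.~-sym H (proj₂ (ni z))

-- Degree bounds and claw components.

AtLeast AtMost : (G : Graph) → Vertex G → ℕ → Set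
AtLeast G x n = Σ (Vec (Vertex G) n) λ ys → Unique ys × All (G [ x ~_]) ys
AtMost  G x n = Σ (Vec (Vertex G) n) λ ys → ∀ {w} → G [ x ~ w ] → w ∈ ys

-- Pigeonhole: distinct neighbours have distinct positions in the covering list.
atLeast-≤-atMost : ∀ {x m n} → AtLeast G x m → AtMost G x n → m ≤ n
atLeast-≤-atMost {G} {x} (ys , distinct , adj) (zs , cover) =
  injective⇒≤ {f = λ i → index (member i)} λ {i} {j} eq →
    Unique.lookup-injective distinct i j
      (trans (lookup-index (member i))
        (trans (cong (lookup zs) eq) (sym (lookup-index (member j)))))
  where
  member : ∀ i → lookup ys i ∈ zs
  member i = cover (All.lookup⁺ adj i)

-- A component S(1,1,1), described from its centre: the degree is exactly three and all neighbours
-- are leaves.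
record Claw (G : Graph) : Set where
  field
    centre  : Vertex G
    atLeast : AtLeast G centre 3
    atMost  : AtMost G centre 3
    leaves  : ∀ {w u} → G [ centre ~ w ] → G [ w ~ u ] → u ≡ centre

claw-resp : G ≃ H → Claw G → Claw H
claw-resp {G} {H} φ claw = record
  { centre  = to centre
  ; atLeast = let ys , u , a = atLeast in
      map to ys , Unique.map⁺ to-injective u , All.map⁺ (All.map hom a)
  ; atMost  = let zs , cover = atMost in
      map to zs , λ {w} p → subst (_∈ map to zs) (to-from w) (∈-map⁺ to (cover (from-centre p)))
  ; leaves  = λ {w} {u} p q →
      trans (sym (to-from u)) (cong to (leaves (from-centre p) (back q)))
  }
  where
  open Claw claw
  open Iso φ
  from-centre : ∀ {w} → H [ to centre ~ w ] → G [ centre ~ from w ]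
  from-centre {w} p = subst (λ v → G [ v ~ from w ]) (from-to centre) (back p)

claw-⊕ : ∀ K → Claw (Spider 1 ⊕ K)
claw-⊕ K = record
  { centre  = inj₁ (rest c₀)
  ; atLeast = inj₁ top ∷ inj₁ (rest a₀) ∷ inj₁ (rest b₀) ∷ []
      , (((λ ()) ∷ (λ ()) ∷ []) ∷ ((λ ()) ∷ []) ∷ [] ∷ [])
      , (left bridge⁻¹ ∷ left (inr ca) ∷ left (inr cb) ∷ [])
  ; atMost  = inj₁ top ∷ inj₁ (rest a₀) ∷ inj₁ (rest b₀) ∷ []
      , λ { (left bridge⁻¹) → here refl ; (left (inr ca)) → there (here refl)
          ; (left (inr cb)) → there (there (here refl))
          ; (left (inr (inr (inr ())))) }
  ; leaves  = λ { (left bridge⁻¹) (left bridge) → refl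
                ; (left bridge⁻¹) (left (inl ()))
                ; (left (inr ca)) (left (inr ac)) → refl
                ; (left (inr ca)) (left (inr (inr (inl ()))))
                ; (left (inr cb)) (left (inr bc)) → refl
                ; (left (inr cb)) (left (inr (inl ())))
                ; (left (inr (inr (inr ())))) _ }
  }

rest-atMost : ∀ X {q k} → q ≢ root X → AtMost (graph X) q k →
  AtMost (graph (grow X)) (rest q) k
rest-atMost X q≢root (ys , cover) = map rest ys , λ where
  (inr p)  → ∈-map⁺ rest (cover p)
  bridge⁻¹ → ⊥-elim (q≢root refl)

spider-degree-≤2 : ∀ n {q} → q ≢ cᴮ n → AtMost (Spider n) q 2
-- A covering list may repeat entries, so a single neighbour is listed twice to reach length 2.
spider-degree-≤2 zero {a₀} _ = c₀ ∷ c₀ ∷ [] , λ { ac → here refl ; (inr (inl ())) }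
spider-degree-≤2 zero {b₀} _ = c₀ ∷ c₀ ∷ [] , λ { bc → here refl ; (inl ()) }
spider-degree-≤2 zero {c₀} q≢c = ⊥-elim (q≢c refl)
spider-degree-≤2 (suc n) {top} _ =
  rest (root (B n)) ∷ rest (root (B n)) ∷ [] , λ { bridge → here refl ; (inl ()) }
spider-degree-≤2 (suc (suc n)) {rest top} _ = rest (rest (root (B n))) ∷ top ∷ []
  , λ { (inr bridge) → here refl ; bridge⁻¹ → there (here refl) ; (inr (inl ())) }
spider-degree-≤2 (suc zero) {rest q} q≢c =
  rest-atMost (B 0) (q≢c ∘ cong rest) (spider-degree-≤2 zero (q≢c ∘ cong rest))
spider-degree-≤2 (suc (suc n)) {rest (rest q)} q≢c =
  rest-atMost (B (suc n)) (λ ()) (spider-degree-≤2 (suc n) (q≢c ∘ cong rest))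

TriangleFree : Graph → Set
TriangleFree G = ∀ {u v w} → G [ u ~ v ] → G [ v ~ w ] → ¬ G [ u ~ w ]

join-triangleFree : ∀ X Y → TriangleFree (graph X) → TriangleFree (graph Y) → TriangleFree (join X Y)
join-triangleFree X Y tf-X tf-Y = λ where
  (inl p)  (inl q)  (inl r)  → tf-X p q r
  (inr p)  (inr q)  (inr r)  → tf-Y p q r
  (inl p)  bridge   bridge   → Graph.~-irrefl (graph X) p
  bridge   (inr q)  bridge   → Graph.~-irrefl (graph Y) q
  bridge   bridge⁻¹ (inl r)  → Graph.~-irrefl (graph X) r
  bridge⁻¹ (inl q)  bridge⁻¹ → Graph.~-irrefl (graph X) q
  bridge⁻¹ bridge   (inr r)  → Graph.~-irrefl (graph Y) r
  (inr p)  bridge⁻¹ bridge⁻¹ → Graph.~-irrefl (graph Y) p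

spider-triangleFree : ∀ n → TriangleFree (Spider n)
spider-triangleFree zero = join-triangleFree point (pendant point at rest tt) (λ ())
  (join-triangleFree point point (λ ()) (λ ()))
spider-triangleFree (suc n) = join-triangleFree point (B n) (λ ()) (spider-triangleFree n)

-- Edges whose deletion leaves a claw component.

-- The vertices of the long leg at distance 1 and 2 from the centre, numbered as on a spine that
-- begins at the centre.
v₂ v₃ : ∀ n → Vertex (Spider (2 + n))
v₂ zero    = rest top
v₂ (suc n) = rest (v₂ n)
v₃ zero    = top
v₃ (suc n) = rest (v₃ n)

c~v₂ : ∀ n → Spider (2 + n) [ cᴮ (2 + n) ~ v₂ n ]
c~v₂ zero    = inr bridge⁻¹
c~v₂ (suc n) = inr (c~v₂ n)

v₂~v₃ : ∀ n → Spider (2 + n) [ v₂ n ~ v₃ n ]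
v₂~v₃ zero    = bridge⁻¹
v₂~v₃ (suc n) = inr (v₂~v₃ n)

v₃≢c : ∀ n → v₃ n ≢ cᴮ (2 + n)
v₃≢c zero    ()
v₃≢c (suc n) p = v₃≢c n (inj₂-injective p)

v₂≢c : ∀ n → v₂ n ≢ cᴮ (2 + n)
v₂≢c zero    ()
v₂≢c (suc n) p = v₂≢c n (inj₂-injective p)

v₂≢a : ∀ n → v₂ n ≢ aᴮ (2 + n)
v₂≢a zero    ()
v₂≢a (suc n) p = v₂≢a n (inj₂-injective p)

v₂≢b : ∀ n → v₂ n ≢ bᴮ (2 + n)
v₂≢b zero    ()
v₂≢b (suc n) p = v₂≢b n (inj₂-injective p)

c-nbr : ∀ n {w} → Spider (2 + n) [ cᴮ (2 + n) ~ w ] →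
  w ≡ v₂ n ⊎ w ∈ (aᴮ (2 + n) ∷ bᴮ (2 + n) ∷ [])
c-nbr zero (inr (inr ca)) = inj₂ (here refl)
c-nbr zero (inr (inr cb)) = inj₂ (there (here refl))
c-nbr zero (inr bridge⁻¹) = inj₁ refl
c-nbr zero (inr (inr (inr (inr ()))))
c-nbr (suc n) (inr p) with c-nbr n p
... | inj₁ eq                  = inj₁ (cong rest eq)
... | inj₂ (here eq)           = inj₂ (here (cong rest eq))
... | inj₂ (there (here eq))   = inj₂ (there (here (cong rest eq)))

-- The leaves of the spider are `a`, `b` and the root, and their neighbours are `c` and `rest top`.
-- Hence a neighbour of any other vertex has two neighbours.
another-neighbour : ∀ n {p u} → p ≢ cᴮ (2 + n) → p ≢ rest top → Spider (2 + n) [ p ~ u ] →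
  ∃[ u′ ] (Spider (2 + n) [ u ~ u′ ] × u′ ≢ p)
another-neighbour n {p} {u} p≢c p≢r p~u with kind (2 + n) u
... | isA = ⊥-elim (p≢c (a-nbr (2 + n) (Graph.~-sym (Spider (2 + n)) p~u)))
... | isB = ⊥-elim (p≢c (b-nbr (2 + n) (Graph.~-sym (Spider (2 + n)) p~u)))
another-neighbour n p≢c p≢r (inl ()) | isRoot
another-neighbour n p≢c p≢r bridge⁻¹ | isRoot = ⊥-elim (p≢r refl)
... | inner (two {x} {y} x≢y u~x u~y) with Graph._≟ᵛ_ (Spider (2 + n)) x p
... | no x≢p   = x , u~x , x≢p
... | yes refl = y , u~y , x≢y ∘ sym

3≰2 : ¬ 3 ≤ 2
3≰2 (s≤s (s≤s ()))

-- Unless p is the parent of the root (the case H ≃ C), only one edge can be deleted to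
-- create a claw component: if c is not adjacent to v₂ after the deletion, the edge is c v₂, and
-- otherwise v₂ must become a leaf.  A claw centred at p ≢ c would need two deletions.
data ClawEdge (n : ℕ) (p : Vertex (Spider (2 + n))) (s t : ⊤ ⊎ Vertex (Spider (2 + n))) : Set where
  at-c     : p ≡ cᴮ (2 + n) → SameEnds (rest (cᴮ (2 + n))) (rest (v₂ n)) s t → ClawEdge n p s t
  beyond-c : p ≢ cᴮ (2 + n) → SameEnds (rest (v₂ n)) (rest (v₃ n)) s t → ClawEdge n p s t

claw-edge-unique : ∀ n {p s t s′ t′} →
  ClawEdge n p s t → ClawEdge n p s′ t′ → SameEnds s t s′ t′
claw-edge-unique n (at-c _ s)      (at-c _ s′)     = same-trans (same-sym s) s′
claw-edge-unique n (at-c ≡c _)     (beyond-c ≢c _) = ⊥-elim (≢c ≡c)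
claw-edge-unique n (beyond-c ≢c _) (at-c ≡c _)     = ⊥-elim (≢c ≡c)
claw-edge-unique n (beyond-c _ s)  (beyond-c _ s′) = same-trans (same-sym s) s′

module _ {n} {p : Vertex (Spider (2 + n))} (p≢parent : p ≢ rest top)
         (f : Edge (pendant (Spider (2 + n) at p))) where

  private
    S : Graph
    S = Spider (2 + n)
    P : Graph
    P = pendant (S at p)
    c : Vertex S
    c = cᴮ (2 + n)
    open Edge f using (source; target)

  private
    removed : ∀ {u v} → P [ u ~ v ] → ¬ (P - f) [ u ~ v ] → SameEnds u v source target
    removed {u} {v} u~v ¬uv with same? P u v source target
    ... | yes s = s
    ... | no ¬s = ⊥-elim (¬uv (u~v , ¬s))

    Leaves : Vertex P → Set
    Leaves x = ∀ {w u} → (P - f) [ x ~ w ] → (P - f) [ w ~ u ] → u ≡ x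

    centre-c : AtLeast (P - f) (rest c) 3 → AtMost (P - f) (rest c) 3 → Leaves (rest c) → ClawEdge n p source target
    centre-c least most leaves
      with same? P (rest c) (rest (v₂ n)) source target | Graph._≟ᵛ_ S p c
    ... | yes s | yes p≡c = at-c p≡c s
    -- The centre has lost `v₂` without gaining the pendant vertex, so only `a` and `b` remain.
    ... | yes s | no p≢c = ⊥-elim (3≰2 (atLeast-≤-atMost {P - f} least (_ , cover)))
      where
      cover : ∀ {w} → (P - f) [ rest c ~ w ] → w ∈ map rest (aᴮ (2 + n) ∷ bᴮ (2 + n) ∷ [])
      cover (bridge⁻¹ , _) = ⊥-elim (p≢c refl)
      cover (inr q , ¬s) with c-nbr n q
      ... | inj₁ refl = ⊥-elim (¬s s)
      ... | inj₂ w∈   = ∈-map⁺ rest w∈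
    ... | no ¬s | p≟c = v₂-leaf p≟c (removed (inr (v₂~v₃ n))
            λ q → v₃≢c n (inj₂-injective (leaves (inr (c~v₂ n) , ¬s) q)))
      where
      v₂-leaf : Dec (p ≡ c) → SameEnds (rest (v₂ n)) (rest (v₃ n)) source target → ClawEdge n p source target
      v₂-leaf (no p≢c)   s = beyond-c p≢c s
      -- The deleted edge `v₂v₃` does not meet `c`, which keeps the four neighbours `top`, `v₂`, `a`
      -- and `b`.
      v₂-leaf (yes refl) s = ⊥-elim (4≰3 (atLeast-≤-atMost {P - f} four most))
        where
        4≰3 : ¬ 4 ≤ 3
        4≰3 (s≤s q) = 3≰2 q
        kept : ∀ {w} → ¬ SameEnds (rest c) w source target
        kept s′ with same-trans s′ (same-sym s)
        ... | inj₁ (eq , _) = v₂≢c n (sym (inj₂-injective eq))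
        ... | inj₂ (eq , _) = v₃≢c n (sym (inj₂-injective eq))
        four : AtLeast (P - f) (rest c) 4
        four = top ∷ rest (v₂ n) ∷ rest (aᴮ (2 + n)) ∷ rest (bᴮ (2 + n)) ∷ []
          , (((λ ()) ∷ (λ ()) ∷ (λ ()) ∷ [])
            ∷ (v₂≢a n ∘ inj₂-injective ∷ v₂≢b n ∘ inj₂-injective ∷ [])
            ∷ (a≢b (2 + n) ∘ inj₂-injective ∷ []) ∷ [] ∷ [])
          , ((bridge⁻¹ , kept) ∷ (inr (c~v₂ n) , kept)
            ∷ (inr (c~a (2 + n)) , kept) ∷ (inr (c~b (2 + n)) , kept) ∷ [])

    Adjacent : Vertex S → Set
    Adjacent u = (P - f) [ rest p ~ rest u ]

    spider-pair : AtLeast (P - f) (rest p) 3 → ∃[ u ] ∃[ w ] (u ≢ w × Adjacent u × Adjacent w)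
    spider-pair (top ∷ top ∷ _ , (ne ∷ _) ∷ _ , _) = ⊥-elim (ne refl)
    spider-pair (top ∷ rest u ∷ top ∷ [] , (_ ∷ ne ∷ []) ∷ _ , _) = ⊥-elim (ne refl)
    spider-pair (top ∷ rest u ∷ rest w ∷ [] , _ ∷ (ne ∷ []) ∷ _ , _ ∷ q ∷ r ∷ []) =
      u , w , ne ∘ cong rest , q , r
    spider-pair (rest u ∷ rest w ∷ _ , (ne ∷ _) ∷ _ , q ∷ r ∷ _) = u , w , ne ∘ cong rest , q , r
    spider-pair (rest u ∷ top ∷ rest w ∷ [] , (_ ∷ ne ∷ []) ∷ _ , q ∷ _ ∷ r ∷ []) =
      u , w , ne ∘ cong rest , q , r
    spider-pair (rest u ∷ top ∷ top ∷ [] , _ ∷ (ne ∷ []) ∷ _ , _) = ⊥-elim (ne refl)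

    in-spider : ∀ {u} → Adjacent u → S [ p ~ u ]
    in-spider (inr q , _) = q

    -- Two neighbours `u` and `w` of `p` in the spider would both have to lose an edge to a further
    -- neighbour. Only `f` is deleted, so these edges coincide, and then `u = w` or `p`, `u`, `w`
    -- form a triangle.
    not-at-p : p ≢ c → AtLeast (P - f) (rest p) 3 → ¬ Leaves (rest p)
    not-at-p p≢c least leaves with spider-pair least
    ... | u , w , u≢w , pu , pw = clash (beyond pu) (beyond pw)
      where
      Beyond : Vertex S → Set
      Beyond u = ∃[ u′ ] (S [ u ~ u′ ] × SameEnds (rest u) (rest u′) source target)
      beyond : ∀ {u} → Adjacent u → Beyond u
      beyond pu =
        let u′ , u~u′ , u′≢p = another-neighbour n p≢c p≢parent (in-spider pu) in
        u′ , u~u′ , removed (inr u~u′) (λ q → u′≢p (inj₂-injective (leaves pu q)))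
      clash : Beyond u → Beyond w → ⊥
      clash (u′ , u~u′ , s) (w′ , w~w′ , s′) with same-trans s (same-sym s′)
      ... | inj₁ (eq , _) = u≢w (inj₂-injective eq)
      ... | inj₂ (refl , refl) =
        spider-triangleFree (2 + n) (in-spider pu) u~u′ (in-spider pw)

  -- By degrees the centre can only be `c` or `p`: the pendant vertex has one neighbour, and the
  -- other spider vertices have at most two.
  claw-edge : Claw (pendant (Spider (2 + n) at p) - f) → ClawEdge n p source target
  claw-edge claw = by-centre centre atLeast atMost leaves
    where
    open Claw claw
    by-centre : ∀ x → AtLeast (P - f) x 3 → AtMost (P - f) x 3 → Leaves x → ClawEdge n p source target
    by-centre top least _ _ with s≤s () ← atLeast-≤-atMost {P - f} least
      (rest p ∷ [] , λ { (bridge , _) → here refl ; (inl () , _) })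
    by-centre (rest q) least most leaves with Graph._≟ᵛ_ S q c
    ... | yes refl = centre-c least most leaves
    ... | no q≢c with Graph._≟ᵛ_ S q p
    ... | yes refl = ⊥-elim (not-at-p q≢c least leaves)
    ... | no q≢p with ys , cover ← rest-atMost (S at p) q≢p (spider-degree-≤2 (2 + n) q≢c) =
      ⊥-elim (3≰2 (atLeast-≤-atMost {P - f} least (ys , λ (q , _) → cover q)))

-- Three edges that determine C.

-- The new vertex and the end of the long leg become the two leaves of a cherry centred at the
-- parent.
pendant-at-parent : ∀ X → pendant (graph (grow (grow X)) at rest top) ≃ join cherry X
pendant-at-parent X = mk≃
  (mk↔ₛ′
    (λ { top → inj₁ a₀ ; (rest top) → inj₁ b₀
       ; (rest (rest top)) → inj₁ c₀ ; (rest (rest (rest u))) → inj₂ u })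
    (λ { (inj₁ a₀) → top ; (inj₁ b₀) → rest top
       ; (inj₁ c₀) → rest (rest top) ; (inj₂ u) → rest (rest (rest u)) })
    (λ { (inj₁ a₀) → refl ; (inj₁ b₀) → refl ; (inj₁ c₀) → refl ; (inj₂ u) → refl })
    (λ { top → refl ; (rest top) → refl
       ; (rest (rest top)) → refl ; (rest (rest (rest u))) → refl }))
  (λ { (inl ()) ; (inr (inl ())) ; (inr (inr (inl ())))
     ; bridge → inl ac ; bridge⁻¹ → inl ca ; (inr bridge) → inl bc ; (inr bridge⁻¹) → inl cb
     ; (inr (inr bridge)) → bridge ; (inr (inr bridge⁻¹)) → bridge⁻¹
     ; (inr (inr (inr p))) → inr p })
  (λ { (inl (inl ())) ; (inl (inr (inl ()))) ; (inl (inr (inr ())))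
     ; (inl ac) → bridge ; (inl ca) → bridge⁻¹ ; (inl bc) → inr bridge ; (inl cb) → inr bridge⁻¹
     ; bridge → inr (inr bridge) ; bridge⁻¹ → inr (inr bridge⁻¹)
     ; (inr p) → inr (inr (inr p)) })

delete-noIsolated : (f : Edge G) → NoIsolated (G - f) → NoIsolated G
delete-noIsolated f ni u = let v , u~v , _ = ni u in v , u~v

-- By `reattach`, `H` is the spider with a pendant vertex at some `p`. If `p` is not the parent of
-- the root, uniqueness of the claw edge would identify `f₁` and `f₂`.
determined : ∀ m (f₀ f₁ f₂ : Edge H) → ¬ f₁ ≈ f₂ →
  H - f₀ ≃ Point ⊕ Spider (2 + m) → NoIsolated (H - f₁) → Claw (H - f₁) → Claw (H - f₂) →
  H ≃ M m
determined {H} m f₀ f₁ f₂ f₁≉f₂ φ ni claw₁ claw₂ =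
  let p , θ = reattach {H} {Spider (2 + m)} f₀ φ (delete-noIsolated {H} f₁ ni) in
  attached p θ (Graph._≟ᵛ_ (Spider (2 + m)) p (rest top))
  where
  P : Vertex (Spider (2 + m)) → Graph
  P p = pendant (Spider (2 + m) at p)
  attached : ∀ p → H ≃ P p → Dec (p ≡ rest top) → H ≃ M m
  attached _ θ (yes refl)    = ≃-trans θ (pendant-at-parent (B m))
  attached p θ (no p≢parent) = ⊥-elim (f₁≉f₂ (mapEdge-injective {H} {P p} θ {f₁} {f₂}
    (claw-edge-unique m {p}
      (clawEdge f₁ claw₁) (clawEdge f₂ claw₂))))
    where
    open _≃_ θ using (to)
    clawEdge : ∀ f → Claw (H - f) → ClawEdge m p (to (Edge.source f)) (to (Edge.target f))
    clawEdge f claw = claw-edge {m} {p} p≢parent (mapEdge θ f)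
      (claw-resp {H - f} {P p - mapEdge θ f} (delete-iso {H} {P p} θ f) claw)

-- `J` is a copy of `M m` in a form in which the three edges are easy to name.
record DeterminingEdges (m : ℕ) (J : Graph) : Set where
  field
    e         : Fin 3 → Edge J
    distinct  : Distinct e
    leafCard  : J - e zero ≃ Point ⊕ Spider (2 + m)
    unisolate : NoIsolated (J - e (suc zero))
    claw₁     : Claw (J - e (suc zero))
    claw₂     : Claw (J - e (suc (suc zero)))
    shape     : J ≃ M m

-- Rotation hands path vertices over to `X` until the right side is `B 2`, where `v₃` is the top and
-- the edge is its stem.
delete-v₂v₃-claw : ∀ r X →
  Claw (join X (B (2 + r)) - inrEdge X (B (2 + r)) (edge (v₂~v₃ r)))
delete-v₂v₃-claw zero X = claw-resp
  (≃-trans (≃-sym (delete-inr-stem X (B 1))) (delete-reverse {join X (B 2)} (edge (inr bridge))))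
  (claw-⊕ (graph (grow X)))
delete-v₂v₃-claw (suc r) X = claw-resp
  (≃-sym (delete-iso (≃-sym (rotate X (B (2 + r)))) (edge (inr (inr (v₂~v₃ r))))))
  (delete-v₂v₃-claw r (grow X))

joinEdges : ∀ X Y → Edge (graph X) → Edge (graph Y) → Fin 3 → Edge (join X Y)
joinEdges X Y e f zero             = inlEdge X Y e
joinEdges X Y e f (suc zero)       = bridgeEdge X Y
joinEdges X Y e f (suc (suc zero)) = inrEdge X Y f

joinEdges-distinct : ∀ X Y e f → Distinct (joinEdges X Y e f)
joinEdges-distinct X Y e f {zero}         {zero}         _ = refl
joinEdges-distinct X Y e f {zero}         {suc zero}     (inj₁ (_ , ()))
joinEdges-distinct X Y e f {zero}         {suc zero}     (inj₂ (() , _))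
joinEdges-distinct X Y e f {zero}         {suc (suc zero)} (inj₁ (() , _))
joinEdges-distinct X Y e f {zero}         {suc (suc zero)} (inj₂ (() , _))
joinEdges-distinct X Y e f {suc zero}     {zero}         (inj₁ (_ , ()))
joinEdges-distinct X Y e f {suc zero}     {zero}         (inj₂ (_ , ()))
joinEdges-distinct X Y e f {suc zero}     {suc zero}     _ = refl
joinEdges-distinct X Y e f {suc zero}     {suc (suc zero)} (inj₁ (() , _))
joinEdges-distinct X Y e f {suc zero}     {suc (suc zero)} (inj₂ (() , _))
joinEdges-distinct X Y e f {suc (suc zero)} {zero}       (inj₁ (() , _))
joinEdges-distinct X Y e f {suc (suc zero)} {zero}       (inj₂ (() , _))
joinEdges-distinct X Y e f {suc (suc zero)} {suc zero}   (inj₁ (() , _))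
joinEdges-distinct X Y e f {suc (suc zero)} {suc zero}   (inj₂ (_ , ()))
joinEdges-distinct X Y e f {suc (suc zero)} {suc (suc zero)} _ = refl

-- C(2,0,2) has two spine edges, and deleting either leaves a claw and a cherry.
determiningEdges-1 : DeterminingEdges 1 (join (B 0) (B 1))
determiningEdges-1 = record
  { e         = joinEdges (B 0) (B 1) (edge ac) (edge bridge)
  ; distinct  = joinEdges-distinct (B 0) (B 1) (edge ac) (edge bridge)
  ; leafCard  = delete-ac (B 1)
  ; unisolate = noIsolated-resp bridge-card
      (⊕-noIsolated {Spider 1} {Spider 0} (spider-noIsolated 1) (spider-noIsolated 0))
  ; claw₁     = claw-resp (≃-sym bridge-card) (claw-⊕ (Spider 0))
  ; claw₂     = claw-resp
      (≃-sym (≃-trans (delete-inr-stem (B 0) (B 0)) (⊕-comm (Spider 0) (Spider 1)))) (claw-⊕ (Spider 0))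
  ; shape     = ≃-refl
  }
  where
  bridge-card : join (B 0) (B 1) - bridgeEdge (B 0) (B 1) ≃ Spider 1 ⊕ Spider 0
  bridge-card = ≃-trans (join-delete (B 0) (B 1)) (⊕-comm (Spider 0) (Spider 1))

-- The bridge cuts off the claw at the left end, the edge `v₂v₃` the one at the right end.
determiningEdges-3+ : ∀ r → DeterminingEdges (3 + r) (join (B 1) (B (2 + r)))
determiningEdges-3+ r = record
  { e         = joinEdges (B 1) (B (2 + r)) (edge (inr ac)) (edge (v₂~v₃ r))
  ; distinct  = joinEdges-distinct (B 1) (B (2 + r)) (edge (inr ac)) (edge (v₂~v₃ r))
  ; leafCard  = ≃-trans
      (delete-iso (rotate (B 0) (B (2 + r))) (inlEdge (B 1) (B (2 + r)) (edge (inr ac))))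
      (delete-ac (B (3 + r)))
  ; unisolate = noIsolated-resp (join-delete (B 1) (B (2 + r)))
      (⊕-noIsolated {Spider 1} {Spider (2 + r)} (spider-noIsolated 1) (spider-noIsolated (2 + r)))
  ; claw₁     = claw-resp (≃-sym (join-delete (B 1) (B (2 + r)))) (claw-⊕ (Spider (2 + r)))
  ; claw₂     = delete-v₂v₃-claw r (B 1)
  ; shape     = rotate (B 0) (B (2 + r))
  }

reconstructible : ∀ {m J} → G ≃ M m → DeterminingEdges m J → ReconstructibleFrom G 3
reconstructible {G} {m} {J} φ d = (λ i → mapEdge θ (e i))
  , (λ {i} {j} s → distinct (mapEdge-injective θ {e i} {e j} s))
  , λ H f f-distinct cards →
      let cardsᴶ = λ i → ≃-trans (cards i) (≃-sym (delete-iso θ (e i))) in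
      ≃-trans
        (determined m (f zero) (f (suc zero)) (f (suc (suc zero)))
          (λ s → 1≢2 (f-distinct s))
          (≃-trans (cardsᴶ zero) leafCard)
          (noIsolated-resp (cardsᴶ (suc zero)) unisolate)
          (claw-resp (≃-sym (cardsᴶ (suc zero))) claw₁)
          (claw-resp (≃-sym (cardsᴶ (suc (suc zero)))) claw₂))
        (≃-sym φ)
  where
  open DeterminingEdges d
  θ : J ≃ G
  θ = ≃-trans shape (≃-sym φ)
  1≢2 : ¬ _≡_ {A = Fin 3} (suc zero) (suc (suc zero))
  1≢2 ()

-- The caterpillar of the statement as a join of spiders.

module _ {n} (k : ℕ) (v : Vec ℕ (suc n)) where

  private
    hub tail : Rooted
    hub  = C (k ∷ []) at spine zero
    tail = C v at spine zero
    split-vertex : Vertex (C (k ∷ v)) → Vertex (join hub tail)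
    split-vertex (spine zero)     = inj₁ (spine zero)
    split-vertex (spine (suc i))  = inj₂ (spine i)
    split-vertex (leaf zero j)    = inj₁ (leaf zero j)
    split-vertex (leaf (suc i) j) = inj₂ (leaf i j)
    merge-vertex : Vertex (join hub tail) → Vertex (C (k ∷ v))
    merge-vertex (inj₁ (spine zero))  = spine zero
    merge-vertex (inj₁ (leaf zero j)) = leaf zero j
    merge-vertex (inj₂ (spine i))     = spine (suc i)
    merge-vertex (inj₂ (leaf i j))    = leaf (suc i) j
    toℕ≡0 : ∀ {n} {i : Fin (suc n)} → suc (toℕ i) ≡ 1 → i ≡ zero
    toℕ≡0 {i = zero} _ = refl
    hom : ∀ u w → C (k ∷ v) [ u ~ w ] → join hub tail [ split-vertex u ~ split-vertex w ]
    hom (spine zero)     (spine zero)     (inj₁ ())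
    hom (spine zero)     (spine zero)     (inj₂ ())
    hom (spine zero)     (spine (suc j))  (inj₁ p) with refl ← toℕ≡0 {i = j} p = bridge
    hom (spine (suc i))  (spine zero)     (inj₂ p) with refl ← toℕ≡0 {i = i} p = bridge⁻¹
    hom (spine (suc i))  (spine (suc j))  (inj₁ p) = inr (inj₁ (suc-injective p))
    hom (spine (suc i))  (spine (suc j))  (inj₂ p) = inr (inj₂ (suc-injective p))
    hom (spine zero)     (leaf zero j)    p        = inl refl
    hom (spine (suc i))  (leaf (suc _) j) refl     = inr refl
    hom (leaf zero j)    (spine zero)     p        = inl refl
    hom (leaf (suc i) j) (spine (suc _))  refl     = inr refl
    back : ∀ u w → join hub tail [ u ~ w ] → C (k ∷ v) [ merge-vertex u ~ merge-vertex w ]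
    back (inj₁ (spine zero))  (inj₁ (spine zero))  (inl (inj₁ ()))
    back (inj₁ (spine zero))  (inj₁ (spine zero))  (inl (inj₂ ()))
    back (inj₁ (spine zero))  (inj₁ (leaf zero j)) _ = refl
    back (inj₁ (leaf zero j)) (inj₁ (spine zero))  _ = refl
    back (inj₁ (leaf zero _)) (inj₁ (leaf zero _)) (inl ())
    back (inj₂ (spine i))     (inj₂ (spine j))     (inr (inj₁ p)) = inj₁ (cong suc p)
    back (inj₂ (spine i))     (inj₂ (spine j))     (inr (inj₂ p)) = inj₂ (cong suc p)
    back (inj₂ (spine i))     (inj₂ (leaf _ _))    (inr refl) = refl
    back (inj₂ (leaf _ _))    (inj₂ (spine _))     (inr refl) = refl
    back (inj₂ (leaf _ _))    (inj₂ (leaf _ _))    (inr ())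
    back (inj₁ _) (inj₂ _) bridge   = inj₁ refl
    back (inj₂ _) (inj₁ _) bridge⁻¹ = inj₂ refl

  -- The first spine edge serves as the bridge, which opens `C` to recursion on the vector.
  caterpillar-cons : (C (k ∷ v) at spine zero) ≅ (join hub tail at inj₁ (spine zero))
  caterpillar-cons = record
    { iso = mk≃
        (mk↔ₛ′ split-vertex merge-vertex
          (λ { (inj₁ (spine zero)) → refl ; (inj₁ (leaf zero j)) → refl
             ; (inj₂ (spine i)) → refl ; (inj₂ (leaf i j)) → refl })
          (λ { (spine zero) → refl ; (spine (suc i)) → refl
             ; (leaf zero j) → refl ; (leaf (suc i) j) → refl }))
        (λ {u} {w} → hom u w) (λ {u} {w} → back u w)
    ; root-≡ = refl }

single-0 : (C (0 ∷ []) at spine zero) ≅ point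
single-0 = record
  { iso = mk≃
      (mk↔ₛ′ (λ { (spine zero) → tt ; (leaf zero ()) }) (λ _ → spine zero)
        (λ _ → refl) (λ { (spine zero) → refl ; (leaf zero ()) }))
      (λ {u} {w} → no-edge u w) (λ ())
  ; root-≡ = refl }
  where
  no-edge : ∀ u w → C (0 ∷ []) [ u ~ w ] → ⊥
  no-edge (spine zero) (spine zero) (inj₁ ())
  no-edge (spine zero) (spine zero) (inj₂ ())
  no-edge (spine zero) (leaf zero ())
  no-edge (leaf zero ())

single-2 : (C (2 ∷ []) at spine zero) ≅ cherry
single-2 = record
  { iso = mk≃ (mk↔ₛ′ to from to-from from-to) (λ {u} {w} → hom u w) back
  ; root-≡ = refl }
  where
  to : Vertex (C (2 ∷ [])) → Vertex (Spider 0)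
  to (spine zero)            = c₀
  to (leaf zero zero)        = a₀
  to (leaf zero (suc zero))  = b₀
  from : Vertex (Spider 0) → Vertex (C (2 ∷ []))
  from c₀ = spine zero
  from a₀ = leaf zero zero
  from b₀ = leaf zero (suc zero)
  to-from : ∀ u → to (from u) ≡ u
  to-from c₀ = refl
  to-from a₀ = refl
  to-from b₀ = refl
  from-to : ∀ u → from (to u) ≡ u
  from-to (spine zero)           = refl
  from-to (leaf zero zero)       = refl
  from-to (leaf zero (suc zero)) = refl
  hom : ∀ u w → C (2 ∷ []) [ u ~ w ] → Spider 0 [ to u ~ to w ]
  hom (spine zero)           (spine zero)           (inj₁ ())
  hom (spine zero)           (spine zero)           (inj₂ ())
  hom (spine zero)           (leaf zero zero)       _ = ca
  hom (spine zero)           (leaf zero (suc zero)) _ = cb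
  hom (leaf zero zero)       (spine zero)           _ = ac
  hom (leaf zero (suc zero)) (spine zero)           _ = bc
  back : ∀ {u w} → Spider 0 [ u ~ w ] → C (2 ∷ []) [ from u ~ from w ]
  back (inl ())
  back (inr (inl ()))
  back (inr (inr ()))
  back ac = refl
  back ca = refl
  back bc = refl
  back cb = refl

half-caterpillar : ∀ m → (C (replicate m 0 ∷ʳ 2) at spine zero) ≅ B m
half-caterpillar zero    = single-2
half-caterpillar (suc m) = ≅-trans (caterpillar-cons 0 (replicate m 0 ∷ʳ 2)) (record
  { iso = join-cong single-0 (half-caterpillar m) ; root-≡ = refl })

caterpillar : ∀ m → C (2 ∷ (replicate m 0 ∷ʳ 2)) ≃ M m
caterpillar m = ≃-trans (iso (caterpillar-cons 2 (replicate m 0 ∷ʳ 2)))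
  (join-cong single-2 (half-caterpillar m))

-- Longest paths and the parity of the diameter.

mapPath : ∀ {k} (g : Vertex G → Vertex H) → (∀ {u v} → g u ≡ g v → u ≡ v) →
  (∀ {u v} → G [ u ~ v ] → H [ g u ~ g v ]) → Path G k → Path H k
mapPath g inj hom π = record
  { vertex = g ∘ vertex ; injective = injective ∘ inj ; adjacent = hom ∘ adjacent }
  where open Path π

consPath : ∀ {k x} (π : Path G k) → G [ x ~ Path.vertex π zero ] →
  (∀ i → x ≢ Path.vertex π i) → Path G (suc k)
consPath {G} {k} {x} π x~ fresh = record
  { vertex = v
  ; injective = λ {i} {j} → inj i j
  ; adjacent = λ { zero → x~ ; (suc i) → adjacent i } }
  where
  open Path π
  v : Fin (2 + k) → Vertex G
  v zero    = x
  v (suc i) = vertex i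
  inj : ∀ i j → v i ≡ v j → i ≡ j
  inj zero    zero    _ = refl
  inj zero    (suc j) p = ⊥-elim (fresh j p)
  inj (suc i) zero    p = ⊥-elim (fresh i (sym p))
  inj (suc i) (suc j) p = cong suc (injective p)

-- The path runs from the root down the leg to the centre and on to `a`.
spider-path : ∀ n → Σ (Path (Spider n) (suc n)) λ π → Path.vertex π zero ≡ root (B n)
spider-path zero = consPath {Spider 0} {x = c₀} π ca (λ _ ()) , refl
  where
  π : Path (Spider 0) 0
  π = record { vertex = λ _ → a₀ ; injective = λ { {zero} {zero} _ → refl } ; adjacent = λ () }
spider-path (suc n) with π , refl-root ← spider-path n =
  consPath {Spider (suc n)} {x = top} (mapPath {Spider n} {Spider (suc n)} rest inj₂-injective inr π)
    (subst (λ u → Spider (suc n) [ top ~ rest u ]) (sym refl-root) bridge) (λ _ ()) , refl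

M-path : ∀ m → Path (M m) (3 + m)
M-path m with π , refl-root ← spider-path m =
  consPath {M m} {x = inj₁ a₀}
    (consPath {M m} {x = inj₁ c₀} (mapPath {Spider m} {M m} inj₂ inj₂-injective inr π)
      (subst (λ u → M m [ inj₁ c₀ ~ inj₂ u ]) (sym refl-root) bridge) (λ _ ()))
    (inl ac) (λ { zero () ; (suc _) () })

-- A path can only end in leaves: its inner vertices lie on the spine.
path-length : ∀ {s k} (a : Vec ℕ s) → Path (C a) (2 + k) → suc k ≤ s
path-length {s} {k} a π = injective⇒≤ {f = λ i → proj₁ (on-spine i)} λ {i} {j} eq →
  inject₁-injective (Fin.suc-injective (injective
    (trans (proj₂ (on-spine i)) (trans (cong spine eq) (sym (proj₂ (on-spine j)))))))
  where
  open Path π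
  leaf-nbr : ∀ {i j u} → C a [ leaf i j ~ u ] → u ≡ spine i
  leaf-nbr {u = spine _} refl = refl
  apart : ∀ {n} (i : Fin n) → inject₁ (inject₁ i) ≢ suc (suc i)
  apart zero    ()
  apart (suc i) p = apart i (Fin.suc-injective p)
  -- The index `suc (inject₁ i)` runs through the inner vertices of the path. A leaf there would
  -- have its only neighbour both before and after it, against injectivity.
  classify : ∀ i w → vertex (suc (inject₁ i)) ≡ w → ∃[ l ] (w ≡ spine l)
  classify i (spine l)  _  = l , refl
  classify i (leaf l j) eq = ⊥-elim (apart i (injective (trans
    (leaf-nbr (subst (λ x → C a [ x ~ vertex (inject₁ (inject₁ i)) ]) eq
      (Graph.~-sym (C a) {vertex (inject₁ (inject₁ i))} {vertex (suc (inject₁ i))} (adjacent (inject₁ i)))))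
    (sym (leaf-nbr (subst (λ x → C a [ x ~ vertex (suc (suc i)) ]) eq (adjacent (suc i))))))))
  on-spine : ∀ i → ∃[ l ] (vertex (suc (inject₁ i)) ≡ spine l)
  on-spine i = classify i _ refl

diameter : ∀ {d m} → 3 < d → HasDiameter (C (2 ∷ (replicate m 0 ∷ʳ 2))) d → d ≡ 3 + m
diameter {suc zero} (s≤s ())
diameter {suc (suc k)} {m} 3<d (π , longest) = ≤-antisym (s≤s (path-length _ π))
  (longest (3 + m) (mapPath {M m} {C (2 ∷ (replicate m 0 ∷ʳ 2))} from from-injective back (M-path m)))
  where open Iso (caterpillar m)

odd-part : ∀ m → 3 < 3 + m → 2 ∣ 3 + m → ∃[ t ] (m ≡ suc (t + t))
odd-part m 3<d (divides 0 ())
odd-part m 3<d (divides 1 ())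
-- With quotient `t + 2` the equation reads `3 + m = 2t + 4`, whence `m = 2t + 1`.
odd-part m 3<d (divides (suc (suc t)) eq) = t , trans
  (suc-injective (suc-injective (suc-injective eq)))
  (cong suc (trans (*-comm t 2) (cong (t +_) (+-identityʳ t))))

theorem4p2 : ∀ (d m : ℕ) → 3 < d → 2 ∣ d →
    HasDiameter (C (2 ∷ (replicate m 0 ∷ʳ 2))) d →
    HasErn (C (2 ∷ (replicate m 0 ∷ʳ 2))) 3
theorem4p2 d m 3<d 2∣d diam with refl ← diameter {d} {m} 3<d diam
                               with t , refl ← odd-part m 3<d 2∣d =
  upper t (caterpillar (suc (t + t))) , ≥3-cards t (caterpillar (suc (t + t)))
  where
  upper : ∀ t {G} → G ≃ M (suc (t + t)) → ReconstructibleFrom G 3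
  -- For `m = 1` the two claws share the middle spine vertex; from `m = 3` on they lie in disjoint
  -- parts of C, and the edges are chosen differently.
  upper zero    φ = reconstructible φ determiningEdges-1
  upper (suc t) {G} φ = reconstructible
    (subst (λ k → G ≃ M (suc (suc k))) (+-suc t t) φ) (determiningEdges-3+ (t + t))
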